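{- Let $\alpha$ be a composition of $n$, let $J\subset\{1,\dots,n-1\}$ be the set of integers that are not partial sums $\alpha_1+\dots+\alpha_k$ of $\alpha$, and let $U$ be a binary search tree with set of labels $\{1,\dots,n-1\}\setminus J$. The map $I_{U,n}$ is a bijection between $\mathfrak S_\alpha$ and the set of lower sets of $\mathcal R_{U,n}$. Define a partial order $\le_{U,n}$ on $\mathfrak S_\alpha$ by $v\le_{U,n}w$ if and only if $I_{U,n}(v)\subset I_{U,n}(w)$. Then $(\mathfrak S_\alpha,\le_{U,n})$ is a distributive lattice.
   Context: $\mathfrak S_\alpha$ is the set of multipermutations: words of length $n$ with $\alpha_k$ occurrences of the letter $k$ for each $k$. The standardization of $u\in\mathfrak S_\alpha$ is the permutation in $\mathfrak S_n$ obtained by replacing, for each $k$, the occurrences of $k$ from left to right by $\alpha_1+\dots+\alpha_{k-1}+1,\dots,\alpha_1+\dots+\alpha_k$ in increasing order. The poset $\mathcal P_n$ is the set of pairs of integers $(i,j)$ with $1\le i<j\le n$, ordered by $(i_1,j_1)\le(i_2,j_2)$ iff $i_2\le i_1$ and $j_1\le j_2$. $\mathcal P_\alpha$ is its subposet of pairs $(i,j)$ for which there is $m\notin J$ with $i\le m\le j-1$ (these are the possible inversions of standardizations). For $\sigma=\sigma_1\cdots\sigma_{n-1}\in\mathfrak S_{n-1}$ and $1\le k\le n-1$ let $\mathcal R_{\sigma,k}=\{x\in\mathcal P_n: (k,k+1)\le x\text{ and }(\sigma_\ell,\sigma_\ell+1)\not\le x\text{ for all }\ell<\sigma^{ -1}(k)\}$.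 These sets partition $\mathcal P_n$; each gets the induced order and $\mathcal R_\sigma$ is the disjoint union of these posets. The binary search tree of a word with distinct letters has as root its first letter, and its left (resp. right) subtree is the binary search tree of the subword of letters smaller (resp. greater) than the root. $\mathcal R_\sigma,\mathcal R_{\sigma,k}$ depend only on the binary search tree $T$ of $\sigma$ and are written $\mathcal R_T,\mathcal R_{T,k}$. Let $(i_{T,k},j_{T,k})=\max\mathcal R_{T,k}$. For $w\in\mathfrak S_n$ (as a word) let $w^{L,k}$ (resp. $w^{R,k}$) be the subword of values in $[i_{T,k},k]$ (resp. $[k+1,j_{T,k}]$). $I_T(w)\subset\mathcal R_T$ is the set such that for $i_{T,k}\le i\le k$, $k+1\le j\le j_{T,k}$: $(i,j)\in I_T(w)$ iff the value $w^{L,k}_{i-i_{T,k}+1}$ appears after the value $w^{R,k}_{j-k}$ in $w$. Let $T$ be any completion of $U$ to a binary search tree with label set $\{1,\dots,n-1\}$ (obtained by inserting the labels in $J$ below the nodes of $U$). $\mathcal R_{U,n}$ is the restriction of the poset $\mathcal R_T$ to $\mathcal P_\alpha$, and for $u\in\mathfrak S_\alpha$ with standardization $w$, $I_{U,n}(u)=I_T(w)\cap\mathcal P_\alpha$. These do not depend on the choice of $T$. -}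

module Defs where

open import Data.Fin.Base using (Fin; toℕ)
import Data.Fin.Base as Fin
import Data.Fin.Properties as Fin
open import Data.List.Base using (List; []; _∷_; length; lookup; filter; take; sum; map; upTo)
import Data.List.Base as List
open import Data.List.Relation.Unary.All using (All)
open import Data.List.Relation.Binary.Permutation.Propositional using (_↭_)
open import Data.Nat.Base using (ℕ; suc; _+_; _∸_; _≤_; _<_)
open import Data.Nat.Properties using (_≤?_; _<?_)
open import Data.Product.Base using (_×_; _,_; ∃-syntax; Σ-syntax)
open import Data.Tree.Binary using (leaf; node)
import Data.Tree.Binary as Binary
import Data.Tree.Binary.Relation.Unary.All as Tree
open import Data.Unit.Base using (⊤)
open import Data.Vec.Base using (Vec; count; toList)
import Data.Vec.Base as Vec
open import Function.Bundles using (_⇔_)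
open import Level using (0ℓ)
open import Relation.Binary.Core using (Rel)
open import Relation.Binary.PropositionalEquality.Core using (_≡_)
open import Relation.Nullary.Decidable.Core using (_×-dec_)
open import Relation.Nullary.Negation.Core using (¬_)
open import Relation.Unary using (Pred; _∈_; _∉_; _⊆_; _≐_; _∩_; Decidable)

-- 1-based indexing of words: the p-th letter of xs is x.
Entry : {A : Set} → List A → ℕ → A → Set
Entry xs p x = Σ[ f ∈ Fin (length xs) ] suc (toℕ f) ≡ p × lookup xs f ≡ x

AppearsAfter : List ℕ → ℕ → ℕ → Set
AppearsAfter w x y = ∃[ p ] ∃[ q ] Entry w p x × Entry w q y × q < p

valuesIn : ℕ → ℕ → List ℕ → List ℕ
valuesIn a b = filter (λ v → (a ≤? v) ×-dec (v ≤? b))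

IsPermutation : ℕ → List ℕ → Set
IsPermutation m σ = σ ↭ map suc (upTo m)

------------------------------------------------------------------------
-- Compositions and multipermutations

record Composition (n : ℕ) : Set where
  field
    parts    : List ℕ
    positive : All (0 <_) parts
    sums     : sum parts ≡ n

open Composition public

-- m = α₁ + ⋯ + αₖ for some 1 ≤ k ≤ length of α
PartialSum : ∀ {n} → Composition n → Pred ℕ 0ℓ
PartialSum α m = Σ[ k ∈ Fin (length (parts α)) ] m ≡ sum (take (suc (toℕ k)) (parts α))

[1,_-1] : ℕ → Pred ℕ 0ℓ
[1, n -1] m = 1 ≤ m × m < n

J : ∀ {n} → Composition n → Pred ℕ 0ℓ
J {n} α m = m ∈ [1, n -1] × ¬ PartialSum α m

-- The letter k (1-based) is represented by the element k - 1 of Fin.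
record Multiperm {n : ℕ} (α : Composition n) : Set where
  field
    word   : Vec (Fin (length (parts α))) n
    counts : ∀ k → count (k Fin.≟_) word ≡ lookup (parts α) k

open Multiperm public

_≈_ : ∀ {n} {α : Composition n} → Rel (Multiperm α) 0ℓ
u ≈ v = word u ≡ word v

-- An occurrence of the letter k that is the t-th one from the left is
-- replaced by α₁ + ⋯ + αₖ₋₁ + t; here t counts the occurrences of k up to
-- and including the position p.
standardization : ∀ {n} {α : Composition n} → Multiperm α → List ℕ
standardization {α = α} u = List.tabulate λ p →
  let k = Vec.lookup (word u) p in
  sum (take (toℕ k) (parts α))
    + length (filter (k Fin.≟_) (take (suc (toℕ p)) (toList (word u))))

------------------------------------------------------------------------
-- Binary search trees

Tree : Set
Tree = Binary.Tree ℕ ⊤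

data Label (m : ℕ) : Pred Tree 0ℓ where
  root  : ∀ {l r} → Label m (node l m r)
  left  : ∀ {l k r} → Label m l → Label m (node l k r)
  right : ∀ {l k r} → Label m r → Label m (node l k r)

HasLabelSet : Tree → Pred ℕ 0ℓ → Set
HasLabelSet t S = ∀ m → Label m t ⇔ m ∈ S

AllLabels : Pred ℕ 0ℓ → Pred Tree 0ℓ
AllLabels P = Tree.All P (λ _ → ⊤)

data IsBST : Pred Tree 0ℓ where
  leaf : ∀ {x} → IsBST (leaf x)
  node : ∀ {l k r} → AllLabels (_< k) l → AllLabels (k <_) r →
         IsBST l → IsBST r → IsBST (node l k r)

-- The second argument is the binary search tree of the first.  This is the
-- graph of the recursive construction, which is not structurally recursive.
data BSTOf : List ℕ → Tree → Set where
  leaf : ∀ {x} → BSTOf [] (leaf x)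
  node : ∀ {k w l r} → BSTOf (filter (_<? k) w) l → BSTOf (filter (k <?_) w) r →
         BSTOf (k ∷ w) (node l k r)

-- t is obtained from s by attaching further nodes below the nodes of s.
data _⊑_ : Tree → Tree → Set where
  leaf : ∀ {x t} → leaf x ⊑ t
  node : ∀ {l k r l′ r′} → l ⊑ l′ → r ⊑ r′ → node l k r ⊑ node l′ k r′

record IsCompletion (n : ℕ) (U T : Tree) : Set where
  field
    isBST    : IsBST T
    labelSet : HasLabelSet T [1, n -1]
    extends  : U ⊑ T

------------------------------------------------------------------------
-- The posets

_≤ᴾ_ : Rel (ℕ × ℕ) 0ℓ
(i₁ , j₁) ≤ᴾ (i₂ , j₂) = i₂ ≤ i₁ × j₁ ≤ j₂

P : ℕ → Pred (ℕ × ℕ) 0ℓ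
P n (i , j) = 1 ≤ i × i < j × j ≤ n

Pα : ∀ {n} → Composition n → Pred (ℕ × ℕ) 0ℓ
Pα {n} α (i , j) = (i , j) ∈ P n × ∃[ m ] m ∉ J α × i ≤ m × m < j

-- p is σ⁻¹(k); such a p exists only if k is a letter of σ.
Rₖ : ℕ → List ℕ → ℕ → Pred (ℕ × ℕ) 0ℓ
Rₖ n σ k x =
  x ∈ P n × (k , suc k) ≤ᴾ x ×
  ∃[ p ] Entry σ p k × (∀ ℓ s → ℓ < p → Entry σ ℓ s → ¬ ((s , suc s) ≤ᴾ x))

IsMax : Pred (ℕ × ℕ) 0ℓ → ℕ × ℕ → Set
IsMax S m = m ∈ S × (∀ x → x ∈ S → x ≤ᴾ m)

-- The order of the disjoint union of the posets Rₖ n σ k.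
_⊢_≤ᴿ_ : ℕ × List ℕ → Rel (ℕ × ℕ) 0ℓ
(n , σ) ⊢ x ≤ᴿ y = ∃[ k ] x ∈ Rₖ n σ k × y ∈ Rₖ n σ k × x ≤ᴾ y

-- I_T(w), where T is the binary search tree of σ and (a , b) is
-- (i_{T,k} , j_{T,k}).
Iᵀ : ℕ → List ℕ → List ℕ → Pred (ℕ × ℕ) 0ℓ
Iᵀ n σ w (i , j) =
  ∃[ k ] ∃[ a ] ∃[ b ] IsMax (Rₖ n σ k) (a , b) ×
  (a ≤ i × i ≤ k) × (suc k ≤ j × j ≤ b) ×
  ∃[ x ] ∃[ y ] Entry (valuesIn a k w) (suc (i ∸ a)) x ×
                Entry (valuesIn (suc k) b w) (j ∸ k) y ×
                AppearsAfter w x y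

-- A subset of a finite poset is rendered as a decidable predicate; this is
-- no restriction classically.
record IsLowerSet (S : Pred (ℕ × ℕ) 0ℓ) (_≤_ : Rel (ℕ × ℕ) 0ℓ)
                  (L : Pred (ℕ × ℕ) 0ℓ) : Set where
  field
    decidable : Decidable L
    subset    : L ⊆ S
    lower     : ∀ {x y} → x ∈ S → y ∈ L → x ≤ y → x ∈ L

-- Throughout, U is represented by a word σ whose binary search tree is a
-- completion of U.
module _ {n : ℕ} (α : Composition n) (σ : List ℕ) where

  -- R_{U,n} is the set ⋃ₖ Rₖ n σ k ∩ Pα α with the order _≤ᴿ_.
  R : Pred (ℕ × ℕ) 0ℓ
  R x = (∃[ k ] x ∈ Rₖ n σ k) × x ∈ Pα α

  I : Multiperm α → Pred (ℕ × ℕ) 0ℓ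
  I u = Iᵀ n σ (standardization u) ∩ Pα α

  IsLowerSetOfR : Pred (ℕ × ℕ) 0ℓ → Set
  IsLowerSetOfR = IsLowerSet R ((n , σ) ⊢_≤ᴿ_)

  LowerSets : Set₁
  LowerSets = Σ[ L ∈ Pred (ℕ × ℕ) 0ℓ ] IsLowerSetOfR L

  _≐ᴸ_ : Rel LowerSets 0ℓ
  (L , _) ≐ᴸ (M , _) = L ≐ M

  _≤ᵁ_ : Rel (Multiperm α) 0ℓ
  u ≤ᵁ v = I u ⊆ I v

{-# OPTIONS --safe #-}

-- Write w for the standardization of u. For a node k of T, whose subtree carries the labels
-- a, …, b - 1, the set R_k is the rectangle a ≤ i ≤ k < j ≤ b, and I_T(w) ∩ R_k records how the
-- subwords of w on the values [a , k] and [k + 1 , b] are shuffled to give the subword on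
-- [a , b]. Shuffles of two words correspond to lower sets of a rectangle, so, going through T
-- from the leaves to the root, I_T(w) determines w, and every family of lower sets of the
-- rectangles occurs. The standardizations are the permutations in which m precedes m + 1 for all
-- m ∈ J. All labels below a node in J are in J, so for such a node the subword on [a , b] is
-- a, a + 1, …, b and R_k does not meet P_α; for a node k ∉ J one has R_k ⊆ P_α. Unions and
-- intersections of lower sets are lower sets, which gives the distributive lattice.

module Submission where

open import Defs
open import Data.Bool.Base using (if_then_else_)
open import Data.Fin.Base using (Fin; zero; suc; toℕ; fromℕ<)
import Data.Fin.Properties as Fin
open import Data.List.Base
  using (List; []; _∷_; _++_; [_]; length; lookup; filter; iterate; take)
import Data.List.Base as List
open import Data.List.Membership.Propositional using (_∈_)
open import Data.List.Membership.Propositional.Properties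
  using (∈-∃++; ∈-lookup; ∈-filter⁺; ∈-filter⁻; ∈-++⁺ˡ; ∈-++⁺ʳ; ∈-++⁻)
open import Data.List.Properties
  using (length-++; length-iterate; length-tabulate; filter-++; filter-all; filter-none;
         filter-reject; tabulate-cong; ++-identityʳ; ∷-injectiveˡ; ∷-injectiveʳ)
open import Data.List.Relation.Binary.Permutation.Propositional
  using (_↭_; prep; ↭-refl; ↭-reflexive; ↭-sym; ↭-trans; ↭⇒↭ₛ)
open import Data.List.Relation.Binary.Permutation.Propositional.Properties
  using (∈-resp-↭; ↭-length; shift)
import Data.List.Relation.Binary.Permutation.Setoid.Properties as Permutationₛ
open import Data.List.Relation.Binary.Pointwise as Pointwise using (Pointwise; []; _∷_)
open import Data.List.Relation.Binary.Sublist.Propositional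
  using (_⊆_; []; _∷ʳ_; _∷_; ⊆-trans; from∈) renaming (lookup to ⊆-lookup)
open import Data.List.Relation.Binary.Sublist.Propositional.Properties using (filter-⊆; filter⁺)
open import Data.List.Relation.Unary.All as All using (All; []; _∷_)
open import Data.List.Relation.Unary.AllPairs using ([]; _∷_)
open import Data.List.Relation.Unary.Any using (here; there)
open import Data.List.Relation.Unary.Unique.Propositional using (Unique)
import Data.List.Relation.Unary.Unique.Propositional.Properties as Unique
open import Data.Nat.Base
open import Data.Nat.ListAction using (sum)
open import Data.Nat.Properties
open import Data.List.Relation.Binary.Sublist.DecPropositional _≟_ using (_⊆?_)
open import Data.Product.Base using (_×_; _,_; proj₁; proj₂; ∃₂; ∃-syntax; Σ-syntax)
open import Data.Sum.Base as Sum using (_⊎_; inj₁; inj₂; [_,_]′)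
open import Data.Tree.Binary using (leaf; node)
import Data.Tree.Binary.Relation.Unary.All as Tree
open import Data.Unit.Base using (⊤; tt)
open import Data.Vec.Base as Vec using (Vec; []; _∷_; count; toList)
open import Function.Base using (_∘_; id)
open import Function.Bundles using (_⇔_; mk⇔; module Equivalence)
open import Function.Definitions using (Bijective)
open import Level using (0ℓ)
open import Relation.Binary.Core using (Rel)
open import Relation.Binary.Definitions using (tri<; tri≈; tri>)
open import Relation.Binary.Lattice.Structures using (IsDistributiveLattice)
open import Relation.Binary.PropositionalEquality
  using (_≡_; _≢_; refl; sym; trans; cong; cong₂; subst; subst₂; setoid; module ≡-Reasoning)
open import Relation.Nullary.Decidable.Core
  using (Dec; does; yes; no; _×-dec_; _⊎-dec_; ¬?; map′)
open import Relation.Nullary.Negation.Core using (¬_; contradiction)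
open import Relation.Unary using (Pred; Decidable; _≐_; _∪_; _∩_)

-- The definition of I_T speaks of positions: it compares the p-th letter of one subword with the
-- q-th letter of another. A pair of indices thus names the same two values in two words only once
-- their subwords are known to agree, so words are compared subtree by subtree. Positions are
-- translated into `Precedes` as early as possible, because a word without repeated letters is
-- determined by its precedences.
--
-- The word built from a lower set satisfies the condition on m and m + 1 automatically: a lower set
-- contained in P_α is empty on the rectangle of a node in J, and an empty set makes the shuffle put
-- the whole left word before the right one.
--
-- A subtree with labels a, ..., b - 1 governs the values a, ..., b, so an empty subtree still
-- governs one value. For n = 0 there is no value at all, and this case is kept apart.

private
  variable
    A : Set
    x y z : A
    w v xs ys : List A

-- The order of the letters of a word

-- Encoded as a two-letter sublist: the monotonicity of `filter` on sublists then carries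
-- precedences between a word and its subwords of values, and decidability comes for free.
Precedes : List A → A → A → Set
Precedes w x y = x ∷ y ∷ [] ⊆ w

precedes-∈ˡ : Precedes w x y → x ∈ w
precedes-∈ˡ p = ⊆-lookup p (here refl)

precedes-∈ʳ : Precedes w x y → y ∈ w
precedes-∈ʳ p = ⊆-lookup p (there (here refl))

precedes-head : y ∈ w → Precedes (x ∷ w) x y
precedes-head y∈w = refl ∷ from∈ y∈w

precedes-tail : x ≢ z → Precedes (z ∷ w) x y → Precedes w x y
precedes-tail x≢z (_ ∷ʳ p)   = p
precedes-tail x≢z (x≡z ∷ _) = contradiction x≡z x≢z

precedes-∈-tail : Precedes (z ∷ w) x y → y ∈ w
precedes-∈-tail (_ ∷ʳ p) = precedes-∈ʳ p
precedes-∈-tail (_ ∷ p)  = ⊆-lookup p (here refl)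

precedes-irrefl : Unique w → ¬ Precedes w x x
precedes-irrefl (_ ∷ u)  (_ ∷ʳ p)    = precedes-irrefl u p
precedes-irrefl (x∉ ∷ _) (refl ∷ p) = All.lookup x∉ (⊆-lookup p (here refl)) refl

precedes-trans : Unique w → Precedes w x y → Precedes w y z → Precedes w x z
precedes-trans (_ ∷ u)  (_ ∷ʳ p)   (_ ∷ʳ q)   = _ ∷ʳ precedes-trans u p q
precedes-trans (y∉ ∷ _) (_ ∷ʳ p)   (refl ∷ _) = contradiction refl (All.lookup y∉ (precedes-∈ʳ p))
precedes-trans u        (refl ∷ p) q          = precedes-head (precedes-∈-tail q)

precedes-asym : Unique w → Precedes w x y → ¬ Precedes w y x
precedes-asym u p q = precedes-irrefl u (precedes-trans u p q)

precedes-total : x ∈ w → y ∈ w → x ≢ y → Precedes w x y ⊎ Precedes w y x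
precedes-total (here refl) (here refl) x≢y = contradiction refl x≢y
precedes-total (here refl) (there y∈)  _   = inj₁ (precedes-head y∈)
precedes-total (there x∈)  (here refl) _   = inj₂ (precedes-head x∈)
precedes-total (there x∈)  (there y∈)  x≢y =
  Sum.map (_ ∷ʳ_) (_ ∷ʳ_) (precedes-total x∈ y∈ x≢y)

precedes-lookup : (f g : Fin (length w)) → toℕ f < toℕ g → Precedes w (lookup w f) (lookup w g)
precedes-lookup {w = _ ∷ w} zero    (suc g) _         = precedes-head (∈-lookup {xs = w} g)
precedes-lookup {w = _ ∷ _} (suc f) (suc g) (s≤s f<g) = _ ∷ʳ precedes-lookup f g f<g

module _ {ℓ} {P : Pred A ℓ} (P? : Decidable P) where

  precedes-filter⁺ : P x → P y → Precedes w x y → Precedes (filter P? w) x y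
  precedes-filter⁺ {x} {y} px py p = ⊆-trans (pair px py) (filter⁺ P? P? (λ { refl → id }) p)
    where
    pair : P x → P y → x ∷ y ∷ [] ⊆ filter P? (x ∷ y ∷ [])
    pair px py = subst (x ∷ y ∷ [] ⊆_) (sym (filter-all P? (px ∷ py ∷ []))) (refl ∷ refl ∷ [])

  precedes-filter⁻ : Precedes (filter P? w) x y → Precedes w x y
  precedes-filter⁻ p = ⊆-trans p (filter-⊆ P? _)

appearsAfter⇒precedes : ∀ w {x y} → AppearsAfter w x y → Precedes w y x
appearsAfter⇒precedes w (_ , _ , (f , refl , refl) , (g , refl , refl) , s≤s g<f) =
  precedes-lookup {w = w} g f g<f

∈⇒lookup : x ∈ w → ∃[ f ] lookup w f ≡ x
∈⇒lookup (here refl) = zero , refl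
∈⇒lookup (there x∈) with f , eq ← ∈⇒lookup x∈ = suc f , eq

precedes⇒appearsAfter : ∀ w {x y} → Precedes w y x → AppearsAfter w x y
precedes⇒appearsAfter (_ ∷ w) (_ ∷ʳ p)
  with _ , _ , (f , refl , eq) , (g , refl , eq′) , g<f ← precedes⇒appearsAfter w p =
  _ , _ , (suc f , refl , eq) , (suc g , refl , eq′) , s≤s g<f
precedes⇒appearsAfter (_ ∷ w) (refl ∷ p) with f , eq ← ∈⇒lookup (⊆-lookup p (here refl)) =
  _ , _ , (suc f , refl , eq) , (zero , refl , refl) , s≤s (s≤s z≤n)

∈-tail : x ≢ z → x ∈ z ∷ w → x ∈ w
∈-tail x≢z (here x≡z) = contradiction x≡z x≢z
∈-tail x≢z (there x∈) = x∈

-- The first letters x of w and z of v agree: otherwise x would precede z in w, hence in v.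
order-determines : {R : A → A → Set} → Unique w → Unique v →
                   (∀ {x} → x ∈ w → x ∈ v) → (∀ {x} → x ∈ v → x ∈ w) → Pointwise R w v →
                   (∀ {x y} → R x y → Precedes w x y → Precedes v x y) → w ≡ v
order-determines _ _ _ _ [] _ = refl
order-determines {w = x ∷ w} {v = z ∷ v} (x∉w ∷ uw) (z∉v ∷ uv) w⊆v v⊆w (r ∷ rs) ord
  with v⊆w (here refl)
... | there z∈w = contradiction refl (All.lookup z∉v (precedes-∈-tail (ord r (precedes-head z∈w))))
... | here refl = cong (x ∷_) (order-determines uw uv
  (λ y∈ → ∈-tail (λ { refl → All.lookup x∉w y∈ refl }) (w⊆v (there y∈)))
  (λ y∈ → ∈-tail (λ { refl → All.lookup z∉v y∈ refl }) (v⊆w (there y∈)))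
  rs
  (λ r′ p → precedes-tail (λ { refl → All.lookup x∉w (precedes-∈ˡ p) refl }) (ord r′ (x ∷ʳ p))))

-- Words without repeated letters

unique-⊆⇒↭ : Unique xs → (∀ {x} → x ∈ xs → x ∈ ys) → ∃[ zs ] ys ↭ xs ++ zs
unique-⊆⇒↭ {ys = ys} [] _ = ys , ↭-refl
unique-⊆⇒↭ {xs = x ∷ xs} (x∉xs ∷ u) xs⊆ys
  with as , bs , refl ← ∈-∃++ (xs⊆ys (here refl))
  with zs , p ← unique-⊆⇒↭ {ys = as ++ bs} u
         (λ y∈ → [ ∈-++⁺ˡ , (λ y∈xbs → ∈-++⁺ʳ as
                     (∈-tail (λ { refl → All.lookup x∉xs y∈ refl }) y∈xbs)) ]′
                   (∈-++⁻ as (xs⊆ys (there y∈))))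
  = zs , ↭-trans (shift x as bs) (prep x p)

unique-⊆⇒length≤ : Unique xs → (∀ {x} → x ∈ xs → x ∈ ys) → length xs ≤ length ys
unique-⊆⇒length≤ {xs = xs} {ys = ys} u xs⊆ys with zs , p ← unique-⊆⇒↭ u xs⊆ys = begin
  length xs               ≤⟨ m≤m+n _ _ ⟩
  length xs + length zs   ≡⟨ length-++ xs ⟨
  length (xs ++ zs)       ≡⟨ ↭-length p ⟨
  length ys               ∎
  where open ≤-Reasoning

-- Pigeonhole: nothing is left over. This is how `standardization` is seen to have no repeated
-- letters, since it has length n and contains 1, ..., n.
unique-⊆⇒↭-length : Unique xs → (∀ {x} → x ∈ xs → x ∈ ys) → length ys ≡ length xs → xs ↭ ys
unique-⊆⇒↭-length {xs = xs} {ys = ys} u xs⊆ys len with unique-⊆⇒↭ u xs⊆ys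
... | []     , p = ↭-sym (subst (ys ↭_) (++-identityʳ xs) p)
... | z ∷ zs , p = contradiction (trans (sym len) (trans (↭-length p) (length-++ xs))) (m≢1+m+n′ _)
  where
  m≢1+m+n′ : ∀ m {n} → m ≢ m + suc n
  m≢1+m+n′ m {n} eq = m≢1+m+n m (trans eq (+-suc m n))

unique-resp-↭ : xs ↭ ys → Unique xs → Unique ys
unique-resp-↭ p = Permutationₛ.Unique-resp-↭ (setoid _) (↭⇒↭ₛ p)

pointwise-universal : length xs ≡ length ys → Pointwise (λ _ _ → ⊤) xs ys
pointwise-universal {xs = []}     {ys = []}     _  = []
pointwise-universal {xs = _ ∷ _} {ys = _ ∷ _} eq = tt ∷ pointwise-universal (suc-injective eq)

-- Words enumerating an interval of integers

iterate-∈⁻ : ∀ a l {x} → x ∈ iterate suc a l → a ≤ x × x < a + l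
iterate-∈⁻ a (suc l) (here refl) = ≤-refl , m<m+n a z<s
iterate-∈⁻ a (suc l) (there x∈) with 1+a≤x , x<1+a+l ← iterate-∈⁻ (suc a) l x∈ =
  <⇒≤ 1+a≤x , <-≤-trans x<1+a+l (≤-reflexive (sym (+-suc a l)))

iterate-∈⁺ : ∀ a l {x} → a ≤ x → x < a + l → x ∈ iterate suc a l
iterate-∈⁺ a zero    a≤x x<a+l = contradiction a≤x (<⇒≱ (<-≤-trans x<a+l (≤-reflexive (+-identityʳ a))))
iterate-∈⁺ a (suc l) a≤x x<a+l with m≤n⇒m<n∨m≡n a≤x
... | inj₁ a<x  = there (iterate-∈⁺ (suc a) l a<x (<-≤-trans x<a+l (≤-reflexive (+-suc a l))))
... | inj₂ refl = here refl

iterate-unique : ∀ a l → Unique (iterate suc a l)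
iterate-unique a zero    = []
iterate-unique a (suc l) =
  All.tabulate (λ y∈ → <⇒≢ (proj₁ (iterate-∈⁻ (suc a) l y∈))) ∷ iterate-unique (suc a) l

iterate-precedes : ∀ a l {x} → a ≤ x → suc x < a + l → Precedes (iterate suc a l) x (suc x)
iterate-precedes a zero    a≤x x<a+l =
  contradiction (m≤n⇒m≤1+n a≤x) (<⇒≱ (<-≤-trans x<a+l (≤-reflexive (+-identityʳ a))))
iterate-precedes a (suc l) a≤x x<a+l with m≤n⇒m<n∨m≡n a≤x
... | inj₁ a<x  = a ∷ʳ iterate-precedes (suc a) l a<x (<-≤-trans x<a+l (≤-reflexive (+-suc a l)))
... | inj₂ refl = precedes-head (iterate-∈⁺ (suc a) l ≤-refl
                   (<-≤-trans x<a+l (≤-reflexive (+-suc a l))))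

-- Both ends are included, whereas label ranges of trees exclude the upper end: labels a, ..., b - 1
-- separate the values a, ..., b.
record Enumerates (a b : ℕ) (w : List ℕ) : Set where
  field
    unique   : Unique w
    sound    : ∀ {x} → x ∈ w → a ≤ x × x ≤ b
    complete : ∀ {x} → a ≤ x → x ≤ b → x ∈ w

open Enumerates public

valuesIn-∈⁻ : ∀ a b w {x} → x ∈ valuesIn a b w → x ∈ w × a ≤ x × x ≤ b
valuesIn-∈⁻ a b w = ∈-filter⁻ (λ v → (a ≤? v) ×-dec (v ≤? b)) {xs = w}

valuesIn-∈⁺ : ∀ a b w {x} → x ∈ w → a ≤ x → x ≤ b → x ∈ valuesIn a b w
valuesIn-∈⁺ a b w x∈ a≤x x≤b = ∈-filter⁺ (λ v → (a ≤? v) ×-dec (v ≤? b)) x∈ (a≤x , x≤b)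

valuesIn-precedes⁻ : ∀ a b w {x y} → Precedes (valuesIn a b w) x y → Precedes w x y
valuesIn-precedes⁻ a b w = precedes-filter⁻ (λ v → (a ≤? v) ×-dec (v ≤? b)) {w = w}

valuesIn-precedes⁺ : ∀ a b w {x y} → a ≤ x × x ≤ b → a ≤ y × y ≤ b →
                     Precedes w x y → Precedes (valuesIn a b w) x y
valuesIn-precedes⁺ a b w = precedes-filter⁺ (λ v → (a ≤? v) ×-dec (v ≤? b)) {w = w}

enumerates-valuesIn : ∀ {a b c d w} → Enumerates a b w → a ≤ c → d ≤ b → Enumerates c d (valuesIn c d w)
enumerates-valuesIn {c = c} {d} {w} e a≤c d≤b = record
  { unique   = Unique.filter⁺ _ (unique e)
  ; sound    = proj₂ ∘ valuesIn-∈⁻ c d w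
  ; complete = λ c≤x x≤d →
      valuesIn-∈⁺ c d w (complete e (≤-trans a≤c c≤x) (≤-trans x≤d d≤b)) c≤x x≤d
  }

enumerates-iterate : ∀ a l {b} → a + l ≡ suc b → Enumerates a b (iterate suc a l)
enumerates-iterate a l a+l≡1+b = record
  { unique   = iterate-unique a l
  ; sound    = λ x∈ → let a≤x , x<a+l = iterate-∈⁻ a l x∈
                      in a≤x , s≤s⁻¹ (<-≤-trans x<a+l (≤-reflexive a+l≡1+b))
  ; complete = λ a≤x x≤b → iterate-∈⁺ a l a≤x (<-≤-trans (s≤s x≤b) (≤-reflexive (sym a+l≡1+b)))
  }

enumerates-length : ∀ {a b v w} → Enumerates a b v → Enumerates a b w → length v ≡ length w
enumerates-length {v = v} {w} ev ew = ≤-antisym (half ev ew) (half ew ev)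
  where
  half : ∀ {a b v w} → Enumerates a b v → Enumerates a b w → length v ≤ length w
  half ev ew = unique-⊆⇒length≤ (unique ev) (λ x∈ → let a≤x , x≤b = sound ev x∈ in complete ew a≤x x≤b)

length-enumerates : ∀ {a b w} → a ≤ suc b → Enumerates a b w → a + length w ≡ suc b
length-enumerates {a} {b} {w} a≤1+b e = trans
  (cong (a +_) (trans (enumerates-length e (enumerates-iterate a (suc b ∸ a) (m+[n∸m]≡n a≤1+b)))
                      (length-iterate suc a (suc b ∸ a))))
  (m+[n∸m]≡n a≤1+b)

enumerates-≡ : ∀ {a b v w} → Enumerates a b v → Enumerates a b w →
               (∀ {x y} → Precedes v x y → Precedes w x y) → v ≡ w
enumerates-≡ ev ew ord = order-determines (unique ev) (unique ew)
  (λ x∈ → let a≤x , x≤b = sound ev x∈ in complete ew a≤x x≤b)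
  (λ x∈ → let a≤x , x≤b = sound ew x∈ in complete ev a≤x x≤b)
  (pointwise-universal (enumerates-length ev ew)) (λ _ → ord)

precedes-chain : ∀ {w x y} → Unique w → (∀ m → x ≤ m → m < y → Precedes w m (suc m)) →
                 x < y → Precedes w x y
precedes-chain {y = suc y} u step x<1+y with m≤n⇒m<n∨m≡n (s≤s⁻¹ x<1+y)
... | inj₂ refl = step _ ≤-refl x<1+y
... | inj₁ x<y  = precedes-trans u
  (precedes-chain u (λ m x≤m m<y → step m x≤m (m<n⇒m<1+n m<y)) x<y)
  (step y (<⇒≤ x<y) ≤-refl)

-- Standardization

module _ {m : ℕ} where

  occurrences : Fin m → List (Fin m) → ℕ
  occurrences k = length ∘ filter (k Fin.≟_)

  -- Standardization with arbitrary offsets `s` in place of the sums α₁ + ⋯ + αₖ₋₁. The generality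
  -- is what makes induction on the word possible: dropping the first letter x raises the offset of
  -- x by one (`shiftAt`).
  relabel : ∀ {n} → (Fin m → ℕ) → Vec (Fin m) n → List ℕ
  relabel s xs = List.tabulate λ p →
    let k = Vec.lookup xs p in s k + occurrences k (take (suc (toℕ p)) (toList xs))

  shiftAt : Fin m → (Fin m → ℕ) → Fin m → ℕ
  shiftAt x s k = s k + occurrences k [ x ]

  occurrences-∷ : ∀ k x xs → occurrences k (x ∷ xs) ≡ occurrences k [ x ] + occurrences k xs
  occurrences-∷ k x xs =
    trans (cong length (filter-++ (k Fin.≟_) [ x ] xs)) (length-++ (filter (k Fin.≟_) [ x ]))

  occurrences-self : ∀ x → occurrences x [ x ] ≡ 1
  occurrences-self x with x Fin.≟ x
  ... | yes _  = refl
  ... | no x≢x = contradiction refl x≢x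

  relabel-∷ : ∀ {n} s x (xs : Vec (Fin m) n) →
              relabel s (x ∷ xs) ≡ suc (s x) ∷ relabel (shiftAt x s) xs
  relabel-∷ s x xs = cong₂ _∷_
    (trans (cong (s x +_) (occurrences-self x)) (+-comm (s x) 1))
    (tabulate-cong λ p → let k = Vec.lookup xs p in
      trans (cong (s k +_) (occurrences-∷ k x (take (suc (toℕ p)) (toList xs))))
            (sym (+-assoc (s k) _ _)))

  count≡occurrences : ∀ {n} k (xs : Vec (Fin m) n) → count (k Fin.≟_) xs ≡ occurrences k (toList xs)
  count≡occurrences k []       = refl
  count≡occurrences k (x ∷ xs) with k Fin.≟ x
  ... | yes _ = cong suc (count≡occurrences k xs)
  ... | no _  = count≡occurrences k xs

  -- A sublist rather than mere membership: the order is kept, so this yields both that every value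
  -- of a block occurs and that the values of a block occur in increasing order.
  iterate-⊆-relabel : ∀ {n} s k (xs : Vec (Fin m) n) →
                      iterate suc (suc (s k)) (count (k Fin.≟_) xs) ⊆ relabel s xs
  iterate-⊆-relabel s k []       = []
  iterate-⊆-relabel s k (x ∷ xs) rewrite relabel-∷ s x xs
    with k Fin.≟ x | iterate-⊆-relabel (shiftAt x s) k xs
  ... | yes refl | ih =
    refl ∷ subst (λ c → iterate suc (suc c) (count (x Fin.≟_) xs) ⊆ relabel (shiftAt x s) xs)
             (+-comm (s x) 1) ih
  ... | no k≢x  | ih =
    suc (s x) ∷ʳ subst (λ c → iterate suc (suc c) (count (k Fin.≟_) xs) ⊆ relabel (shiftAt x s) xs)
             (+-identityʳ (s k)) ih

  relabel-bounds : ∀ {n} s (xs : Vec (Fin m) n) →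
                   Pointwise (λ k v → s k < v × v ≤ s k + count (k Fin.≟_) xs) (toList xs) (relabel s xs)
  relabel-bounds s []       = []
  relabel-bounds s (x ∷ xs) rewrite relabel-∷ s x xs =
    (≤-refl , subst (λ c → suc (s x) ≤ s x + c) (sym (count-∷ x)) head≤)
    ∷ Pointwise.map (λ {k} (lo , hi) → ≤-<-trans (m≤m+n (s k) _) lo ,
                     ≤-trans hi (≤-reflexive
                       (trans (+-assoc (s k) _ _) (cong (s k +_) (sym (count-∷ k))))))
        (relabel-bounds (shiftAt x s) xs)
    where
    count-∷ : ∀ k → count (k Fin.≟_) (x ∷ xs) ≡ occurrences k [ x ] + count (k Fin.≟_) xs
    count-∷ k = trans (count≡occurrences k (x ∷ xs))
      (trans (occurrences-∷ k x (toList xs))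
             (cong (occurrences k [ x ] +_) (sym (count≡occurrences k xs))))
    head≤ : suc (s x) ≤ s x + (occurrences x [ x ] + count (x Fin.≟_) xs)
    head≤ rewrite occurrences-self x = ≤-trans (s≤s (m≤m+n (s x) _)) (≤-reflexive (sym (+-suc (s x) _)))

length-filter-pointwise :
  ∀ {A B : Set} {R : A → B → Set} {P : A → Set} {Q : B → Set} (P? : Decidable P) (Q? : Decidable Q) →
  (∀ {x y} → R x y → P x → Q y) → (∀ {x y} → R x y → Q y → P x) →
  ∀ {xs ys} → Pointwise R xs ys → length (filter P? xs) ≡ length (filter Q? ys)
length-filter-pointwise P? Q? P⇒Q Q⇒P [] = refl
length-filter-pointwise P? Q? P⇒Q Q⇒P {x ∷ xs} {y ∷ ys} (r ∷ rs)
  with P? x | Q? y | length-filter-pointwise P? Q? P⇒Q Q⇒P rs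
... | yes _ | yes _ | ih = cong suc ih
... | yes p | no ¬q | _  = contradiction (P⇒Q r p) ¬q
... | no ¬p | yes q | _  = contradiction (Q⇒P r q) ¬p
... | no _  | no _  | ih = ih

-- The values that standardization assigns to the letter k.
InBlock : (ps : List ℕ) → Fin (length ps) → ℕ → Set
InBlock ps k v = sum (take (toℕ k) ps) < v × v ≤ sum (take (suc (toℕ k)) ps)

sum-take-suc : ∀ ps (k : Fin (length ps)) →
               sum (take (suc (toℕ k)) ps) ≡ sum (take (toℕ k) ps) + lookup ps k
sum-take-suc (p ∷ ps) zero    = +-comm p 0
sum-take-suc (p ∷ ps) (suc k) = trans (cong (p +_) (sum-take-suc ps k)) (sym (+-assoc p _ _))

sum-take-mono : ∀ ps {i j} → i ≤ j → sum (take i ps) ≤ sum (take j ps)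
sum-take-mono ps       z≤n       = z≤n
sum-take-mono []       (s≤s i≤j) = z≤n
sum-take-mono (p ∷ ps) (s≤s i≤j) = +-monoʳ-≤ p (sum-take-mono ps i≤j)

sum-take≤sum : ∀ i ps → sum (take i ps) ≤ sum ps
sum-take≤sum zero    ps       = z≤n
sum-take≤sum (suc i) []       = z≤n
sum-take≤sum (suc i) (p ∷ ps) = +-monoʳ-≤ p (sum-take≤sum i ps)

block-of : ∀ ps {v} → 0 < v → v ≤ sum ps → ∃[ k ] InBlock ps k v
block-of []       0<v v≤0 = contradiction v≤0 (<⇒≱ 0<v)
block-of (p ∷ ps) {v} 0<v v≤p+s with v ≤? p
... | yes v≤p = zero , 0<v , ≤-trans v≤p (m≤m+n p 0)
... | no v≰p with k , lo , hi ← block-of ps {v ∸ p} (m<n⇒0<n∸m (≰⇒> v≰p)) (m≤n+o⇒m∸n≤o _ p v≤p+s) =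
  suc k ,
  <-≤-trans (+-monoʳ-< p lo) (≤-reflexive (m+[n∸m]≡n (≰⇒≥ v≰p))) ,
  ≤-trans (≤-reflexive (sym (m+[n∸m]≡n (≰⇒≥ v≰p)))) (+-monoʳ-≤ p hi)

block-unique : ∀ ps {k l v} → InBlock ps k v → InBlock ps l v → k ≡ l
block-unique ps {k} {l} (k< , ≤k) (l< , ≤l) with <-cmp (toℕ k) (toℕ l)
... | tri≈ _ eq _  = Fin.toℕ-injective eq
... | tri< k<l _ _ = contradiction (≤-trans ≤k (sum-take-mono ps k<l)) (<⇒≱ l<)
... | tri> _ _ l<k = contradiction (≤-trans ≤l (sum-take-mono ps l<k)) (<⇒≱ k<)

-- The image of standardization

module _ {n : ℕ} (α : Composition n) where

  SameBlock : ℕ → ℕ → Set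
  SameBlock x y = ∃[ k ] InBlock (parts α) k x × InBlock (parts α) k y

  record IsStandard (w : List ℕ) : Set where
    field
      enumerates : Enumerates 1 n w
      ascending  : ∀ {m} → J α m → Precedes w m (suc m)

  open IsStandard public

  -- A block contains no partial sum except its last value: sums with index below k are smaller than
  -- x, those with index from k on are at least y.
  sameBlock⇒J : ∀ {x y m} → SameBlock x y → x ≤ m → m < y → J α m
  sameBlock⇒J {x} {y} {m} (k , (k<x , _) , (_ , y≤k)) x≤m m<y =
    (≤-trans (≤-<-trans z≤n k<x) x≤m ,
     <-≤-trans m<y (≤-trans y≤k (≤-trans (sum-take≤sum (suc (toℕ k)) (parts α))
                              (≤-reflexive (sums α)))))
    , λ (l , m≡) → [ l<k m≡ , k≤l m≡ ]′ (m<1+n⊎ l)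
    where
    m<1+n⊎ : ∀ l → toℕ l < toℕ k ⊎ toℕ k ≤ toℕ l
    m<1+n⊎ l = <-≤-connex (toℕ l) (toℕ k)
    l<k : ∀ {l} → m ≡ sum (take (suc (toℕ l)) (parts α)) → toℕ l < toℕ k → _
    l<k refl l<k = <⇒≱ k<x (≤-trans x≤m (sum-take-mono (parts α) l<k))
    k≤l : ∀ {l} → m ≡ sum (take (suc (toℕ l)) (parts α)) → toℕ k ≤ toℕ l → _
    k≤l refl k≤l = <⇒≱ m<y (≤-trans y≤k (sum-take-mono (parts α) (s≤s k≤l)))

  sameBlock-precedes : ∀ {w x y} → IsStandard w → SameBlock x y → x < y → Precedes w x y
  sameBlock-precedes st b = precedes-chain (unique (enumerates st))
    (λ m x≤m m<y → ascending st (sameBlock⇒J b x≤m m<y))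

  module _ (u : Multiperm α) where

    private
      s : Fin (length (parts α)) → ℕ
      s k = sum (take (toℕ k) (parts α))

    standardization-inBlock : Pointwise (InBlock (parts α)) (toList (word u)) (standardization u)
    standardization-inBlock = Pointwise.map
      (λ {k} (lo , hi) → lo , ≤-trans hi (≤-reflexive
        (trans (cong (s k +_) (counts u k)) (sym (sum-take-suc (parts α) k)))))
      (relabel-bounds s (word u))

    block-⊆-standardization : ∀ k → iterate suc (suc (s k)) (lookup (parts α) k) ⊆ standardization u
    block-⊆-standardization k =
      subst (λ c → iterate suc (suc (s k)) c ⊆ standardization u) (counts u k)
        (iterate-⊆-relabel s k (word u))

    standardization-complete : ∀ {v} → 1 ≤ v → v ≤ n → v ∈ standardization u
    standardization-complete {v} 1≤v v≤n
      with k , k<v , v≤k ← block-of (parts α) 1≤v (≤-trans v≤n (≤-reflexive (sym (sums α)))) =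
      ⊆-lookup (block-⊆-standardization k)
        (iterate-∈⁺ (suc (s k)) _ k<v (s≤s (≤-trans v≤k (≤-reflexive (sum-take-suc (parts α) k)))))

    standardization-isStandard : IsStandard (standardization u)
    standardization-isStandard = record
      { enumerates = record
        { unique   = unique-resp-↭ perm (iterate-unique 1 n)
        ; sound    = λ x∈ → let 1≤x , x<1+n = iterate-∈⁻ 1 n (∈-resp-↭ (↭-sym perm) x∈)
                            in 1≤x , s≤s⁻¹ x<1+n
        ; complete = standardization-complete
        }
      ; ascending = asc
      }
      where
      perm = unique-⊆⇒↭-length (iterate-unique 1 n)
        (λ x∈ → let 1≤x , x<1+n = iterate-∈⁻ 1 n x∈ in standardization-complete 1≤x (s≤s⁻¹ x<1+n))
        (trans (length-tabulate _) (sym (length-iterate suc 1 n)))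
      asc : ∀ {m} → J α m → Precedes (standardization u) m (suc m)
      asc {m} ((1≤m , m<n) , ¬ps)
        with k , k<m , m≤k ← block-of (parts α) 1≤m (≤-trans (<⇒≤ m<n) (≤-reflexive (sym (sums α)))) =
        -- Not being a partial sum, m is not the last value of its block, so m + 1 belongs to the
        -- same block.
        ⊆-trans (iterate-precedes (suc (s k)) _ k<m
                  (s≤s (<-≤-trans (≤∧≢⇒< m≤k (λ eq → ¬ps (k , eq)))
                       (≤-reflexive (sum-take-suc (parts α) k)))))
                (block-⊆-standardization k)

  standardization-cong : ∀ {u v : Multiperm α} → word u ≡ word v → standardization u ≡ standardization v
  standardization-cong = cong (relabel (λ k → sum (take (toℕ k) (parts α))))

  toList-injective : ∀ {A : Set} {n} (xs ys : Vec A n) → toList xs ≡ toList ys → xs ≡ ys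
  toList-injective []       []       _  = refl
  toList-injective (x ∷ xs) (y ∷ ys) eq =
    cong₂ _∷_ (∷-injectiveˡ eq) (toList-injective xs ys (∷-injectiveʳ eq))

  inBlock-functional : ∀ {ks ls w} → Pointwise (InBlock (parts α)) ks w →
                       Pointwise (InBlock (parts α)) ls w → ks ≡ ls
  inBlock-functional []       []       = refl
  inBlock-functional (p ∷ ps) (q ∷ qs) =
    cong₂ _∷_ (block-unique (parts α) p q) (inBlock-functional ps qs)

  standardization-injective : ∀ {u v : Multiperm α} → standardization u ≡ standardization v →
                              word u ≡ word v
  standardization-injective {u} {v} eq = toList-injective (word u) (word v) (inBlock-functional
    (subst (Pointwise _ (toList (word u))) eq (standardization-inBlock u)) (standardization-inBlock v))

  blocks-of : ∀ {w} → (∀ {x} → x ∈ w → 1 ≤ x × x ≤ n) → ∃[ ks ] Pointwise (InBlock (parts α)) ks w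
  blocks-of {[]}    _   = [] , []
  blocks-of {x ∷ w} snd
    with 1≤x , x≤n ← snd (here refl)
    with k , inb ← block-of (parts α) 1≤x (≤-trans x≤n (≤-reflexive (sym (sums α))))
    with ks , pw ← blocks-of (snd ∘ there) = k ∷ ks , inb ∷ pw

  occurrences≡valuesIn : ∀ {ks w} k → Pointwise (InBlock (parts α)) ks w →
    occurrences k ks ≡
    length (valuesIn (suc (sum (take (toℕ k) (parts α)))) (sum (take (suc (toℕ k)) (parts α))) w)
  occurrences≡valuesIn k = length-filter-pointwise (k Fin.≟_) _
    (λ { inb refl → inb }) (λ inb inb′ → block-unique (parts α) inb′ inb)

  fromListOfLength : ∀ {A : Set} {n} (xs : List A) → length xs ≡ n → Σ[ ys ∈ Vec A n ] toList ys ≡ xs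
  fromListOfLength []       refl = [] , refl
  fromListOfLength (x ∷ xs) refl with ys , eq ← fromListOfLength xs refl = x ∷ ys , cong (x ∷_) eq

  -- The preimage replaces each value by the letter of its block. Its standardization and `w` then
  -- have values of the same block at each position, so `order-determines` with the relation
  -- `SameBlock` only asks for precedences inside a block, and there both words are increasing.
  standardization-surjective : ∀ {w} → IsStandard w → Σ[ u ∈ Multiperm α ] standardization u ≡ w
  standardization-surjective {w} st
    with ks , pw ← blocks-of (sound (enumerates st))
    with xs , refl ← fromListOfLength {n = n} ks
           (trans (Pointwise.Pointwise-length pw)
           (trans (enumerates-length (enumerates st) (enumerates-iterate 1 n refl))
                  (length-iterate suc 1 n)))
    = u , order-determines (unique (enumerates su)) (unique (enumerates st))
        (λ x∈ → let 1≤x , x≤n = sound (enumerates su) x∈ in complete (enumerates st) 1≤x x≤n)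
        (λ x∈ → let 1≤x , x≤n = sound (enumerates st) x∈ in complete (enumerates su) 1≤x x≤n)
        (sameBlocks (standardization-inBlock u) pw) transfer
    where
    cnt : ∀ k → count (k Fin.≟_) xs ≡ lookup (parts α) k
    cnt k = begin
      count (k Fin.≟_) xs ≡⟨ count≡occurrences k xs ⟩
      occurrences k (toList xs) ≡⟨ occurrences≡valuesIn k pw ⟩
      length (valuesIn (suc S) (sum (take (suc (toℕ k)) (parts α))) w)
        ≡⟨ cong (λ b → length (valuesIn (suc S) b w)) (sum-take-suc (parts α) k) ⟩
      length (valuesIn (suc S) (S + lookup (parts α) k) w)
        ≡⟨ enumerates-length
             (enumerates-valuesIn (enumerates st) (s≤s z≤n)
               (≤-trans (≤-reflexive (sym (sum-take-suc (parts α) k)))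
               (≤-trans (sum-take≤sum (suc (toℕ k)) (parts α)) (≤-reflexive (sums α)))))
             (enumerates-iterate (suc S) (lookup (parts α) k) refl) ⟩
      length (iterate suc (suc S) (lookup (parts α) k)) ≡⟨ length-iterate suc (suc S) _ ⟩
      lookup (parts α) k ∎
      where
      open ≡-Reasoning
      S = sum (take (toℕ k) (parts α))
    u : Multiperm α
    u = record { word = xs ; counts = cnt }
    su : IsStandard (standardization u)
    su = standardization-isStandard u
    sameBlocks : ∀ {ks v w} → Pointwise (InBlock (parts α)) ks v → Pointwise (InBlock (parts α)) ks w →
                 Pointwise SameBlock v w
    sameBlocks []       []       = []
    sameBlocks (p ∷ ps) (q ∷ qs) = (_ , p , q) ∷ sameBlocks ps qs
    transfer : ∀ {x y} → SameBlock x y → Precedes (standardization u) x y → Precedes w x y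
    transfer {x} {y} b@(k , bx , by) p with <-cmp x y
    ... | tri< x<y _ _  = sameBlock-precedes st b x<y
    ... | tri≈ _ refl _ = contradiction p (precedes-irrefl (unique (enumerates su)))
    ... | tri> _ _ y<x  = contradiction p
      (precedes-asym (unique (enumerates su)) (sameBlock-precedes su (k , by , bx) y<x))

-- Binary search trees

-- The labels of t, read from left to right, are a, a + 1, …, b - 1.
data Ranged : Tree → ℕ → ℕ → Set where
  leaf : ∀ {x a} → Ranged (leaf x) a a
  node : ∀ {l k r a b} → Ranged l a k → Ranged r (suc k) b → Ranged (node l k r) a b

ranged-≤ : ∀ {t a b} → Ranged t a b → a ≤ b
ranged-≤ leaf       = ≤-refl
ranged-≤ (node p q) = ≤-trans (ranged-≤ p) (<⇒≤ (ranged-≤ q))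

ranged-label : ∀ {t a b m} → Ranged t a b → Label m t → a ≤ m × m < b
ranged-label (node p q) root      = ranged-≤ p , ranged-≤ q
ranged-label (node p q) (left x)  = let a≤m , m<k = ranged-label p x in a≤m , <-trans m<k (ranged-≤ q)
ranged-label (node p q) (right x) =
  let k<m , m<b = ranged-label q x in ≤-trans (ranged-≤ p) (<⇒≤ k<m) , m<b

allLabels-lookup : ∀ {P : Pred ℕ _} {t m} → AllLabels P t → Label m t → P m
allLabels-lookup (Tree.node l p r) root      = p
allLabels-lookup (Tree.node l p r) (left x)  = allLabels-lookup l x
allLabels-lookup (Tree.node l p r) (right x) = allLabels-lookup r x

-- The hypothesis `a ≤ b` excludes an empty label set given by a > b, which has no `Ranged`
-- counterpart. For the whole tree, with range from 1 to n, it becomes 1 ≤ n.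
isBST⇒ranged : ∀ {t a b} → IsBST t → a ≤ b → (∀ m → Label m t ⇔ (a ≤ m × m < b)) → Ranged t a b
isBST⇒ranged {a = a} leaf a≤b labels with m≤n⇒m<n∨m≡n a≤b
... | inj₂ refl = leaf
... | inj₁ a<b  = contradiction (Equivalence.from (labels a) (≤-refl , a<b)) (λ ())
isBST⇒ranged {node l k r} {a} {b} (node l<k k<r bl br) a≤b labels = node
  (isBST⇒ranged bl (proj₁ (bounds root)) (λ m → mk⇔
    (λ x → proj₁ (bounds (left x)) , allLabels-lookup l<k x)
    (λ (a≤m , m<k) → inˡ m<k (Equivalence.from (labels m) (a≤m , <-trans m<k (proj₂ (bounds root)))))))
  (isBST⇒ranged br (proj₂ (bounds root)) (λ m → mk⇔
    (λ x → allLabels-lookup k<r x , proj₂ (bounds (right x)))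
    (λ (k<m , m<b) → inʳ k<m (Equivalence.from (labels m)
                        (≤-trans (proj₁ (bounds root)) (<⇒≤ k<m) , m<b)))))
  where
  bounds : ∀ {m} → Label m (node l k r) → a ≤ m × m < b
  bounds {m} = Equivalence.to (labels m)
  inˡ : ∀ {m} → m < k → Label m (node l k r) → Label m l
  inˡ m<k root      = contradiction m<k (<-irrefl refl)
  inˡ m<k (left x)  = x
  inˡ m<k (right x) = contradiction m<k (<-asym (allLabels-lookup k<r x))
  inʳ : ∀ {m} → k < m → Label m (node l k r) → Label m r
  inʳ k<m root      = contradiction k<m (<-irrefl refl)
  inʳ k<m (left x)  = contradiction k<m (<-asym (allLabels-lookup l<k x))
  inʳ k<m (right x) = x

-- t, with labels a, …, b - 1, is a subtree of the second tree, with labels A, …, B - 1.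
data Subtree (t : Tree) (a b : ℕ) : Tree → ℕ → ℕ → Set where
  here  : Subtree t a b t a b
  left  : ∀ {l k r A B} → Subtree t a b l A k → Subtree t a b (node l k r) A B
  right : ∀ {l k r A B} → Subtree t a b r (suc k) B → Subtree t a b (node l k r) A B

subtree-left : ∀ {l k r a b T A B} → Subtree (node l k r) a b T A B → Subtree l a k T A B
subtree-left here      = left here
subtree-left (left s)  = left (subtree-left s)
subtree-left (right s) = right (subtree-left s)

subtree-right : ∀ {l k r a b T A B} → Subtree (node l k r) a b T A B → Subtree r (suc k) b T A B
subtree-right here      = right here
subtree-right (left s)  = left (subtree-right s)
subtree-right (right s) = right (subtree-right s)

subtree-ranged : ∀ {t a b T A B} → Ranged T A B → Subtree t a b T A B → Ranged t a b
subtree-ranged p          here      = p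
subtree-ranged (node p q) (left s)  = subtree-ranged p s
subtree-ranged (node p q) (right s) = subtree-ranged q s

subtree-bounds : ∀ {t a b T A B} → Ranged T A B → Subtree t a b T A B → A ≤ a × b ≤ B
subtree-bounds p          here      = ≤-refl , ≤-refl
subtree-bounds (node p q) (left s)  =
  let A≤a , b≤k = subtree-bounds p s in A≤a , ≤-trans b≤k (<⇒≤ (ranged-≤ q))
subtree-bounds (node p q) (right s) =
  let k<a , b≤B = subtree-bounds q s in ≤-trans (ranged-≤ p) (<⇒≤ k<a) , b≤B

NodeAt : Tree → ℕ → ℕ → ℕ → ℕ → ℕ → Set
NodeAt T A B k a b = ∃₂ λ l r → Subtree (node l k r) a b T A B

nodeAt-range : ∀ {T A B k a b} → Ranged T A B → NodeAt T A B k a b → a ≤ k × k < b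
nodeAt-range p (_ , _ , s) with node pl pr ← subtree-ranged p s = ranged-≤ pl , ranged-≤ pr

nodeAt-label : ∀ {T A B k a b} → Ranged T A B → NodeAt T A B k a b → A ≤ k × k < B
nodeAt-label p v@(_ , _ , s) =
  let a≤k , k<b = nodeAt-range p v ; A≤a , b≤B = subtree-bounds p s
  in ≤-trans A≤a a≤k , <-≤-trans k<b b≤B

-- Labels to the left of a root, the root itself and labels to its right are disjoint, so k fixes
-- the path. Nodes produced by different existence statements can therefore be identified.
nodeAt-functional : ∀ {T A B k a b a′ b′} → Ranged T A B →
                    NodeAt T A B k a b → NodeAt T A B k a′ b′ → a ≡ a′ × b ≡ b′
nodeAt-functional p (_ , _ , here) (_ , _ , here) = refl , refl
nodeAt-functional (node p q) (_ , _ , here) (_ , _ , left s) =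
  contradiction (proj₂ (nodeAt-label p (_ , _ , s))) (<-irrefl refl)
nodeAt-functional (node p q) (_ , _ , here) (_ , _ , right s) =
  contradiction (proj₁ (nodeAt-label q (_ , _ , s))) (<-irrefl refl)
nodeAt-functional (node p q) (_ , _ , left s) (_ , _ , here) =
  contradiction (proj₂ (nodeAt-label p (_ , _ , s))) (<-irrefl refl)
nodeAt-functional (node p q) (_ , _ , right s) (_ , _ , here) =
  contradiction (proj₁ (nodeAt-label q (_ , _ , s))) (<-irrefl refl)
nodeAt-functional (node p q) (_ , _ , left s) (_ , _ , left s′) =
  nodeAt-functional p (_ , _ , s) (_ , _ , s′)
nodeAt-functional (node p q) (_ , _ , right s) (_ , _ , right s′) =
  nodeAt-functional q (_ , _ , s) (_ , _ , s′)
nodeAt-functional (node p q) (_ , _ , left s) (_ , _ , right s′) =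
  contradiction (proj₂ (nodeAt-label p (_ , _ , s))) (<-asym (proj₁ (nodeAt-label q (_ , _ , s′))))
nodeAt-functional (node p q) (_ , _ , right s) (_ , _ , left s′) =
  contradiction (proj₂ (nodeAt-label p (_ , _ , s′))) (<-asym (proj₁ (nodeAt-label q (_ , _ , s))))

-- Rectangles of the nodes, and the first letter of a word inside an interval

InRectangle : ℕ → ℕ → ℕ → ℕ × ℕ → Set
InRectangle k a b (i , j) = (a ≤ i × i ≤ k) × (k < j × j ≤ b)

-- Descend as long as i and j lie on the same side of the root. A leaf is never reached, because its
-- range holds a single value. With `nodeAt⇒first` and `first-functional` this is the partition of
-- P_n into the sets R_k.
splitting-node : ∀ {T A B i j} → Ranged T A B → A ≤ i → i < j → j ≤ B →
                 ∃[ k ] ∃[ a ] ∃[ b ] NodeAt T A B k a b × InRectangle k a b (i , j)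
splitting-node leaf A≤i i<j j≤A = contradiction (≤-<-trans A≤i i<j) (≤⇒≯ j≤A)
splitting-node {node l k r} {A} {B} {i} {j} (node p q) A≤i i<j j≤B with i ≤? k | j ≤? k
... | yes i≤k | no j≰k = k , A , B , (_ , _ , here) , (A≤i , i≤k) , (≰⇒> j≰k , j≤B)
... | _       | yes j≤k with k′ , a , b , (_ , _ , s) , rect ← splitting-node p A≤i i<j j≤k =
  k′ , a , b , (_ , _ , left s) , rect
splitting-node {node l k r} (node p q) A≤i i<j j≤B | no i≰k | no _
  with k′ , a , b , (_ , _ , s) , rect ← splitting-node q (≰⇒> i≰k) i<j j≤B =
  k′ , a , b , (_ , _ , right s) , rect

-- k is the first letter s of the word such that (s , s + 1) ≤ (i , j).
data First (i j k : ℕ) : List ℕ → Set where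
  here  : ∀ {w} → i ≤ k → k < j → First i j k (k ∷ w)
  there : ∀ {m w} → ¬ (i ≤ m × m < j) → First i j k w → First i j k (m ∷ w)

first-inside : ∀ {i j k w} → First i j k w → i ≤ k × k < j
first-inside (here i≤k k<j) = i≤k , k<j
first-inside (there _ f)    = first-inside f

first-functional : ∀ {i j k l w} → First i j k w → First i j l w → k ≡ l
first-functional (here _ _)     (here _ _)     = refl
first-functional (here i≤k k<j) (there k∉ _)   = contradiction (i≤k , k<j) k∉
first-functional (there l∉ _)   (here i≤l l<j) = contradiction (i≤l , l<j) l∉
first-functional (there _ f)    (there _ g)    = first-functional f g

module _ {ℓ} {P : Pred ℕ ℓ} (P? : Decidable P) {i j : ℕ} (inside : ∀ {m} → i ≤ m → m < j → P m) where

  -- Discarded letters lie outside [i , j - 1], so they never compete for being the first one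
  -- inside. This passes between a word and the words of its subtrees.
  first-filter⁺ : ∀ {k w} → First i j k w → First i j k (filter P? w)
  first-filter⁺ {k} (here i≤k k<j) with P? k
  ... | yes _ = here i≤k k<j
  ... | no ¬p = contradiction (inside i≤k k<j) ¬p
  first-filter⁺ (there {m} m∉ f) with P? m
  ... | yes _ = there m∉ (first-filter⁺ f)
  ... | no _  = first-filter⁺ f

  first-filter⁻ : ∀ {k} w → First i j k (filter P? w) → First i j k w
  first-filter⁻ (m ∷ w) f with P? m
  first-filter⁻ (m ∷ w) (here i≤k k<j) | yes _ = here i≤k k<j
  first-filter⁻ (m ∷ w) (there m∉ f)   | yes _ = there m∉ (first-filter⁻ w f)
  ... | no ¬p = there (λ (i≤m , m<j) → ¬p (inside i≤m m<j)) (first-filter⁻ w f)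

Rₖ⇒first : ∀ {n σ k i j} → Rₖ n σ k (i , j) → First i j k σ
Rₖ⇒first {σ = σ} (_ , (i≤k , k<j) , (_ , (f , refl , refl) , min)) = go σ f i≤k k<j
    (λ ℓ s ℓ<p e → min ℓ s ℓ<p e)
  where
  go : ∀ {i j} σ f → i ≤ lookup σ f → lookup σ f < j →
       (∀ ℓ s → ℓ < suc (toℕ f) → Entry σ ℓ s → ¬ (i ≤ s × s < j)) → First i j (lookup σ f) σ
  go (m ∷ σ) zero    i≤k k<j min = here i≤k k<j
  go (m ∷ σ) (suc f) i≤k k<j min =
    there (min 1 m (s≤s (s≤s z≤n)) (zero , refl , refl))
      (go σ f i≤k k<j (λ { _ s ℓ<p (g , refl , eq) → min _ s (s≤s ℓ<p) (suc g , refl , eq) }))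

first⇒Rₖ : ∀ {n σ k i j} → P n (i , j) → First i j k σ → Rₖ n σ k (i , j)
first⇒Rₖ ij∈P f = ij∈P , first-inside f , go f
  where
  go : ∀ {σ k i j} → First i j k σ →
       ∃[ p ] Entry σ p k × (∀ ℓ s → ℓ < p → Entry σ ℓ s → ¬ (i ≤ s × s < j))
  go (here _ _) = 1 , (zero , refl , refl) , λ { _ _ (s≤s ()) (_ , refl , _) }
  go (there m∉ f) with _ , (g , refl , eq) , min ← go f = _ , (suc g , refl , eq) , λ
    { _ _ _         (zero  , refl , refl) → m∉
    ; _ s (s≤s ℓ<p) (suc h , refl , eq)   → min _ s ℓ<p (h , refl , eq)
    }

-- If the root m is not in [i , j - 1], this interval lies entirely on one side of m, and the
-- subword for that side has the same first letter inside it.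
first⇒nodeAt : ∀ {σ T A B i j k} → BSTOf σ T → Ranged T A B → A ≤ i → j ≤ B → First i j k σ →
               ∃₂ λ a b → NodeAt T A B k a b × InRectangle k a b (i , j)
first⇒nodeAt (node _ _) (node _ _) A≤i j≤B (here i≤m m<j) =
  _ , _ , (_ , _ , here) , (A≤i , i≤m) , (m<j , j≤B)
first⇒nodeAt {i = i} {j} (node {m} bl br) (node p q) A≤i j≤B (there m∉ f) with j ≤? m
... | yes j≤m with a , b , (_ , _ , s) , rect ← first⇒nodeAt bl p A≤i j≤m
                     (first-filter⁺ (_<? m) (λ _ x<j → <-≤-trans x<j j≤m) f) =
  a , b , (_ , _ , left s) , rect
... | no j≰m =
  let m<i = ≰⇒> (λ i≤m → m∉ (i≤m , ≰⇒> j≰m))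
      a , b , (_ , _ , s) , rect = first⇒nodeAt br q m<i j≤B
        (first-filter⁺ (m <?_) (λ i≤x _ → <-≤-trans m<i i≤x) f)
  in a , b , (_ , _ , right s) , rect

nodeAt⇒first : ∀ {σ T A B i j k a b} → BSTOf σ T → Ranged T A B →
               NodeAt T A B k a b → InRectangle k a b (i , j) → First i j k σ
nodeAt⇒first (node bl br) (node p q) (_ , _ , here) ((_ , i≤k) , (k<j , _)) = here i≤k k<j
nodeAt⇒first (node {m} {w} bl br) (node p q) (_ , _ , left s) rect@((a≤i , i≤k) , (k<j , j≤b)) =
  let j≤m = ≤-trans j≤b (proj₂ (subtree-bounds p s)) in
  there (λ (_ , m<j) → <⇒≱ m<j j≤m)
    (first-filter⁻ (_<? m) (λ _ x<j → <-≤-trans x<j j≤m) w (nodeAt⇒first bl p (_ , _ , s) rect))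
nodeAt⇒first (node {m} {w} bl br) (node p q) (_ , _ , right s) rect@((a≤i , i≤k) , (k<j , j≤b)) =
  let m<i = ≤-trans (proj₁ (subtree-bounds q s)) a≤i in
  there (λ (i≤m , _) → <⇒≱ m<i i≤m)
    (first-filter⁻ (m <?_) (λ i≤x _ → <-≤-trans m<i i≤x) w (nodeAt⇒first br q (_ , _ , s) rect))

-- Labels of a tree and of its completions

⊑-label : ∀ {U T m} → U ⊑ T → Label m U → Label m T
⊑-label (node p q) root      = root
⊑-label (node p q) (left x)  = left (⊑-label p x)
⊑-label (node p q) (right x) = right (⊑-label q x)

-- U is a top part of T. Descending to k in both trees at once, either U ends on the way and nothing
-- below carries a label of U, or k is met as a label of U; labels of U off the path are outside
-- [a , b - 1] by the ranges.
unlabelled-below : ∀ {U T A B k a b m} → U ⊑ T → Ranged T A B → NodeAt T A B k a b →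
                   ¬ Label k U → a ≤ m → m < b → ¬ Label m U
unlabelled-below (node _ _) (node _ _) (_ , _ , here) k∉U _ _ _ = k∉U root
unlabelled-below (node _ _) (node p _) (_ , _ , left s) _ _ m<b root =
  <⇒≱ m<b (proj₂ (subtree-bounds p s))
unlabelled-below (node ul _) (node p _) (_ , _ , left s) k∉U a≤m m<b (left x) =
  unlabelled-below ul p (_ , _ , s) (k∉U ∘ left) a≤m m<b x
unlabelled-below (node _ ur) (node p q) (_ , _ , left s) _ _ m<b (right x) =
  <-asym (<-≤-trans m<b (proj₂ (subtree-bounds p s))) (proj₁ (ranged-label q (⊑-label ur x)))
unlabelled-below (node _ _) (node _ q) (_ , _ , right s) _ a≤m _ root =
  <⇒≱ (proj₁ (subtree-bounds q s)) a≤m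
unlabelled-below (node ul _) (node p q) (_ , _ , right s) _ a≤m _ (left x) =
  <-asym (≤-trans (proj₁ (subtree-bounds q s)) a≤m) (proj₂ (ranged-label p (⊑-label ul x)))
unlabelled-below (node _ ur) (node _ q) (_ , _ , right s) k∉U a≤m m<b (right x) =
  unlabelled-below ur q (_ , _ , s) (k∉U ∘ right) a≤m m<b x

-- Shuffles

-- Lower sets of a rectangle in 0-based coordinates. The first coordinate is reversed as in `_≤ᴾ_`,
-- where a larger i gives a smaller pair.
LowerOn : ℕ → ℕ → (ℕ → ℕ → Set) → Set
LowerOn c d D = ∀ {p p′ q q′} → p ≤ p′ → p′ < c → q′ ≤ q → q < d → D p q → D p′ q′

module _ {A : Set} where

  -- `D p q` demands that letter q of `ys` come before letter p of `xs`. Indices count within what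
  -- remains of the two words, hence the shift of `D?` after each letter placed.
  merge : {D : ℕ → ℕ → Set} → (∀ p q → Dec (D p q)) → List A → List A → List A
  merge D? []       ys       = ys
  merge D? (x ∷ xs) []       = x ∷ xs
  merge D? (x ∷ xs) (y ∷ ys) = if does (D? 0 0)
    then y ∷ merge (λ p q → D? p (suc q)) (x ∷ xs) ys
    else x ∷ merge (λ p q → D? (suc p) q) xs (y ∷ ys)

  merge-↭ : ∀ {D : ℕ → ℕ → Set} (D? : ∀ p q → Dec (D p q)) xs ys → merge D? xs ys ↭ xs ++ ys
  merge-↭ D? []       ys       = ↭-refl
  merge-↭ D? (x ∷ xs) []       = ↭-reflexive (sym (++-identityʳ (x ∷ xs)))
  merge-↭ D? (x ∷ xs) (y ∷ ys)
    with D? 0 0 | merge-↭ (λ p q → D? p (suc q)) (x ∷ xs) ys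
       | merge-↭ (λ p q → D? (suc p) q) xs (y ∷ ys)
  ... | yes _ | ih | _  = ↭-trans (prep y ih) (↭-sym (shift y (x ∷ xs) ys))
  ... | no _  | _  | ih = prep x ih

  merge-∈ˡ : ∀ {D : ℕ → ℕ → Set} (D? : ∀ p q → Dec (D p q)) xs ys {z} → z ∈ xs → z ∈ merge D? xs ys
  merge-∈ˡ D? xs ys z∈ = ∈-resp-↭ (↭-sym (merge-↭ D? xs ys)) (∈-++⁺ˡ z∈)

  merge-∈ʳ : ∀ {D : ℕ → ℕ → Set} (D? : ∀ p q → Dec (D p q)) xs ys {z} → z ∈ ys → z ∈ merge D? xs ys
  merge-∈ʳ D? xs ys z∈ = ∈-resp-↭ (↭-sym (merge-↭ D? xs ys)) (∈-++⁺ʳ xs z∈)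

  module _ {P : A → Set} (P? : Decidable P) where

    filter-mergeˡ : ∀ {D : ℕ → ℕ → Set} (D? : ∀ p q → Dec (D p q)) xs ys → All (λ y → ¬ P y) ys →
                    filter P? (merge D? xs ys) ≡ filter P? xs
    filter-mergeˡ D? []       ys       ¬ys            = filter-none P? ¬ys
    filter-mergeˡ D? (x ∷ xs) []       ¬ys            = refl
    filter-mergeˡ D? (x ∷ xs) (y ∷ ys) ¬yys@(¬y ∷ ¬ys)
      with D? 0 0 | filter-mergeˡ (λ p q → D? p (suc q)) (x ∷ xs) ys ¬ys
         | filter-mergeˡ (λ p q → D? (suc p) q) xs (y ∷ ys) ¬yys
    ... | yes _ | ih | _ = trans (filter-reject P? ¬y) ih
    ... | no _  | _  | ih with P? x
    ...   | yes _ = cong (x ∷_) ih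
    ...   | no _  = ih

    filter-mergeʳ : ∀ {D : ℕ → ℕ → Set} (D? : ∀ p q → Dec (D p q)) xs ys → All (λ x → ¬ P x) xs →
                    filter P? (merge D? xs ys) ≡ filter P? ys
    filter-mergeʳ D? []       ys       ¬xs            = refl
    filter-mergeʳ D? (x ∷ xs) []       ¬xs            = filter-none P? ¬xs
    filter-mergeʳ D? (x ∷ xs) (y ∷ ys) ¬xxs@(¬x ∷ ¬xs)
      with D? 0 0 | filter-mergeʳ (λ p q → D? p (suc q)) (x ∷ xs) ys ¬xxs
         | filter-mergeʳ (λ p q → D? (suc p) q) xs (y ∷ ys) ¬xs
    ... | no _  | _  | ih = trans (filter-reject P? ¬x) ih
    ... | yes _ | ih | _ with P? y
    ...   | yes _ = cong (y ∷_) ih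
    ...   | no _  = ih

  -- `merge` consults D only at the current heads. Putting x first commits it to precede every
  -- letter of `ys`, which agrees with D because `D 0 g` would imply `D 0 0`. In
  -- `merge-precedes-no`, dually, putting y first is justified because `D 0 0` implies `D f 0`.
  merge-precedes-yes : ∀ {D : ℕ → ℕ → Set} (D? : ∀ p q → Dec (D p q)) xs ys →
    LowerOn (length xs) (length ys) D → ∀ f g → D (toℕ f) (toℕ g) → Precedes (merge D? xs ys) (lookup ys g) (lookup xs f)
  merge-precedes-yes D? (x ∷ xs) (y ∷ ys) low f g d
    with D? 0 0 | merge-precedes-yes (λ p q → D? p (suc q)) (x ∷ xs) ys
                    (λ p≤ p< q≤ q< → low p≤ p< (s≤s q≤) (s≤s q<))
                | merge-precedes-yes (λ p q → D? (suc p) q) xs (y ∷ ys)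
                    (λ p≤ p< q≤ q< → low (s≤s p≤) (s≤s p<) q≤ q<)
  merge-precedes-yes D? (x ∷ xs) (y ∷ ys) low f zero d | yes _ | _ | _ =
    precedes-head (merge-∈ˡ (λ p q → D? p (suc q)) (x ∷ xs) ys (∈-lookup {xs = x ∷ xs} f))
  merge-precedes-yes D? (x ∷ xs) (y ∷ ys) low f (suc g) d | yes _ | ih | _ = y ∷ʳ ih f g d
  merge-precedes-yes D? (x ∷ xs) (y ∷ ys) low zero g d | no ¬d | _ | _ =
    contradiction (low z≤n z<s z≤n (Fin.toℕ<n g) d) ¬d
  merge-precedes-yes D? (x ∷ xs) (y ∷ ys) low (suc f) g d | no _ | _ | ih = x ∷ʳ ih f g d

  merge-precedes-no : ∀ {D : ℕ → ℕ → Set} (D? : ∀ p q → Dec (D p q)) xs ys →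
    LowerOn (length xs) (length ys) D → ∀ f g → ¬ D (toℕ f) (toℕ g) → Precedes (merge D? xs ys) (lookup xs f) (lookup ys g)
  merge-precedes-no D? (x ∷ xs) (y ∷ ys) low f g ¬d
    with D? 0 0 | merge-precedes-no (λ p q → D? p (suc q)) (x ∷ xs) ys
                    (λ p≤ p< q≤ q< → low p≤ p< (s≤s q≤) (s≤s q<))
                | merge-precedes-no (λ p q → D? (suc p) q) xs (y ∷ ys)
                    (λ p≤ p< q≤ q< → low (s≤s p≤) (s≤s p<) q≤ q<)
  merge-precedes-no D? (x ∷ xs) (y ∷ ys) low f zero ¬d | yes d | _ | _ =
    contradiction (low z≤n (Fin.toℕ<n f) z≤n z<s d) ¬d
  merge-precedes-no D? (x ∷ xs) (y ∷ ys) low f (suc g) ¬d | yes _ | ih | _ = y ∷ʳ ih f g ¬d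
  merge-precedes-no D? (x ∷ xs) (y ∷ ys) low zero g ¬d | no _ | _ | _ =
    precedes-head (merge-∈ʳ (λ p q → D? (suc p) q) xs (y ∷ ys) (∈-lookup {xs = y ∷ ys} g))
  merge-precedes-no D? (x ∷ xs) (y ∷ ys) low (suc f) g ¬d | no _ | _ | ih = x ∷ʳ ih f g ¬d

enumerates-merge : ∀ {a k b xs ys} {D : ℕ → ℕ → Set} (D? : ∀ p q → Dec (D p q)) → a ≤ k → k < b →
                   Enumerates a k xs → Enumerates (suc k) b ys → Enumerates a b (merge D? xs ys)
enumerates-merge {a} {k} {b} {xs} {ys} D? a≤k k<b ex ey = record
  { unique   = unique-resp-↭ (↭-sym (merge-↭ D? xs ys)) (Unique.++⁺ (unique ex) (unique ey)
      λ (x∈ , y∈) → <⇒≱ (proj₁ (sound ey y∈)) (proj₂ (sound ex x∈)))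
  ; sound    = λ z∈ → [ (λ x∈ → let a≤x , x≤k = sound ex x∈ in a≤x , ≤-trans x≤k (<⇒≤ k<b))
                      , (λ y∈ → let k<y , y≤b = sound ey y∈ in ≤-trans a≤k (<⇒≤ k<y) , y≤b)
                      ]′ (∈-++⁻ xs (∈-resp-↭ (merge-↭ D? xs ys) z∈))
  ; complete = λ {z} a≤z z≤b → [ (λ z≤k → merge-∈ˡ D? xs ys (complete ex a≤z z≤k))
                               , (λ k<z → merge-∈ʳ D? xs ys (complete ey k<z z≤b))
                               ]′ (≤-<-connex z k)
  }

enumerates-index : ∀ {a b w i} → Enumerates a b w → a ≤ suc b → a ≤ i → i ≤ b →
                   ∃[ f ] i ≡ a + toℕ {length w} f
enumerates-index {a} {b} {w} {i} e a≤1+b a≤i i≤b =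
  fromℕ< i∸a< , trans (sym (m+[n∸m]≡n a≤i)) (cong (a +_) (sym (Fin.toℕ-fromℕ< i∸a<)))
  where
  i∸a< : i ∸ a < length w
  i∸a< = +-cancelˡ-< a _ _ (≤-<-trans (≤-reflexive (m+[n∸m]≡n a≤i))
           (<-≤-trans (s≤s i≤b) (≤-reflexive (sym (length-enumerates a≤1+b e)))))

-- Coordinates are brought into the form `a + toℕ f`, `suc k + toℕ g`, in which the truncated
-- subtractions of `Iᵀ` cancel and f, g index the two subwords.
rectangle-index : ∀ {k a b L R i j} → Enumerates a k L → Enumerates (suc k) b R →
                  InRectangle k a b (i , j) →
                  ∃₂ λ (f : Fin (length L)) (g : Fin (length R)) → i ≡ a + toℕ f × j ≡ suc k + toℕ g
rectangle-index eL eR ((a≤i , i≤k) , (k<j , j≤b)) =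
  let f , i≡ = enumerates-index eL (≤-trans a≤i (m≤n⇒m≤1+n i≤k)) a≤i i≤k
      g , j≡ = enumerates-index eR (m≤n⇒m≤1+n (≤-trans k<j j≤b)) k<j j≤b
  in f , g , i≡ , j≡

index-rectangle : ∀ {k a b L R p q} → a ≤ k → k < b → Enumerates a k L → Enumerates (suc k) b R →
                  p < length L → q < length R → InRectangle k a b (a + p , suc k + q)
index-rectangle {k} {a} {b} {L} {R} {p} {q} a≤k k<b eL eR p< q< =
  (m≤m+n a p , bound (m≤n⇒m≤1+n a≤k) eL p<) , (m≤m+n (suc k) q , bound (m≤n⇒m≤1+n k<b) eR q<)
  where
  bound : ∀ {a b w p} → a ≤ suc b → Enumerates a b w → p < length w → a + p ≤ b
  bound {a} a≤1+b e p< =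
    s≤s⁻¹ (<-≤-trans (+-monoʳ-< a p<) (≤-reflexive (length-enumerates a≤1+b e)))

-- The sets R_k as rectangles, and membership in I_T as precedence

module _ {n : ℕ} {σ : List ℕ} {T : Tree} (bst : BSTOf σ T) (ranged : Ranged T 1 n) where

  rectangle⇒P : ∀ {k a b x} → NodeAt T 1 n k a b → InRectangle k a b x → P n x
  rectangle⇒P (_ , _ , s) ((a≤i , i≤k) , (k<j , j≤b)) =
    let 1≤a , b≤n = subtree-bounds ranged s
    in ≤-trans 1≤a a≤i , ≤-<-trans i≤k k<j , ≤-trans j≤b b≤n

  rectangle⇒Rₖ : ∀ {k a b x} → NodeAt T 1 n k a b → InRectangle k a b x → Rₖ n σ k x
  rectangle⇒Rₖ v rect = first⇒Rₖ (rectangle⇒P v rect) (nodeAt⇒first bst ranged v rect)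

  Rₖ⇒nodeAt : ∀ {k x} → Rₖ n σ k x → ∃₂ λ a b → NodeAt T 1 n k a b × InRectangle k a b x
  Rₖ⇒nodeAt x∈@((1≤i , _ , j≤n) , _) = first⇒nodeAt bst ranged 1≤i j≤n (Rₖ⇒first x∈)

  Rₖ⇒rectangle : ∀ {k a b x} → NodeAt T 1 n k a b → Rₖ n σ k x → InRectangle k a b x
  Rₖ⇒rectangle v x∈ with a , b , v′ , rect ← Rₖ⇒nodeAt x∈
    with refl , refl ← nodeAt-functional ranged v v′ = rect

  nodeAt⇒isMax : ∀ {k a b} → NodeAt T 1 n k a b → IsMax (Rₖ n σ k) (a , b)
  nodeAt⇒isMax v =
    let a≤k , k<b = nodeAt-range ranged v
    in rectangle⇒Rₖ v ((≤-refl , a≤k) , (k<b , ≤-refl)) ,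
       λ x x∈ → let (a≤i , _) , (_ , j≤b) = Rₖ⇒rectangle v x∈ in a≤i , j≤b

  isMax⇒nodeAt : ∀ {k a b} → IsMax (Rₖ n σ k) (a , b) → NodeAt T 1 n k a b
  isMax⇒nodeAt (ab∈ , max) with a′ , b′ , v , ((a′≤a , _) , (_ , b≤b′)) ← Rₖ⇒nodeAt ab∈
    with a≤a′ , b′≤b ← max (a′ , b′) (proj₁ (nodeAt⇒isMax v))
    with refl ← ≤-antisym a′≤a a≤a′ | refl ← ≤-antisym b≤b′ b′≤b = v

  -- The k quantified in Iᵀ is forced: it is the first letter of σ in [i , j - 1].
  Iᵀ⇔precedes : ∀ {k a b w L R} → NodeAt T 1 n k a b → valuesIn a k w ≡ L → valuesIn (suc k) b w ≡ R →
    (f : Fin (length L)) (g : Fin (length R)) → InRectangle k a b (a + toℕ f , suc k + toℕ g) →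
    Iᵀ n σ w (a + toℕ f , suc k + toℕ g) ⇔ Precedes w (lookup R g) (lookup L f)
  Iᵀ⇔precedes {k} {a} {b} {w} v refl refl f g rect = mk⇔ to from
    where
    -- Positions in `Iᵀ` are 1-based while f and g count from 0; measuring j from k instead of k + 1
    -- already supplies the extra one.
    i∸a : suc (a + toℕ f ∸ a) ≡ suc (toℕ f)
    i∸a = cong suc (m+n∸m≡n a (toℕ f))
    j∸k : suc k + toℕ g ∸ k ≡ suc (toℕ g)
    j∸k = trans (cong (_∸ k) (sym (+-suc k (toℕ g)))) (m+n∸m≡n k (suc (toℕ g)))
    to : Iᵀ n σ w (a + toℕ f , suc k + toℕ g) →
         Precedes w (lookup (valuesIn (suc k) b w) g) (lookup (valuesIn a k w) f)
    to (k′ , a′ , b′ , max , a≤i≤k , k<j≤b , x , y , ex , ey , after)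
      with v′ ← isMax⇒nodeAt max
      with refl ← first-functional (nodeAt⇒first bst ranged v rect)
                                   (nodeAt⇒first bst ranged v′ (a≤i≤k , k<j≤b))
      with refl , refl ← nodeAt-functional ranged v v′
      with f′ , f′≡ , refl ← ex | g′ , g′≡ , refl ← ey
      with refl ← Fin.toℕ-injective {i = f′} {f} (suc-injective (trans f′≡ i∸a))
         | refl ← Fin.toℕ-injective {i = g′} {g} (suc-injective (trans g′≡ j∸k)) =
      appearsAfter⇒precedes w after
    from : Precedes w (lookup (valuesIn (suc k) b w) g) (lookup (valuesIn a k w) f) →
           Iᵀ n σ w (a + toℕ f , suc k + toℕ g)
    from p = k , a , b , nodeAt⇒isMax v , proj₁ rect , proj₂ rect , _ , _ ,
      (f , sym i∸a , refl) , (g , sym j∸k , refl) , precedes⇒appearsAfter w p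

  enumerates-left : ∀ {k a b w} → NodeAt T 1 n k a b → Enumerates 1 n w →
                    Enumerates a k (valuesIn a k w)
  enumerates-left v@(_ , _ , s) e = enumerates-valuesIn e (proj₁ (subtree-bounds ranged s))
    (<⇒≤ (proj₂ (nodeAt-label ranged v)))

  enumerates-right : ∀ {k a b w} → NodeAt T 1 n k a b → Enumerates 1 n w →
                     Enumerates (suc k) b (valuesIn (suc k) b w)
  enumerates-right v@(_ , _ , s) e = enumerates-valuesIn e (s≤s z≤n) (proj₂ (subtree-bounds ranged s))

  Iᵀ-dec : ∀ {w x} → Enumerates 1 n w → P n x → Dec (Iᵀ n σ w x)
  Iᵀ-dec {w} e (1≤i , i<j , j≤n)
    with k , a , b , v , rect ← splitting-node ranged 1≤i i<j j≤n
    with f , g , refl , refl ← rectangle-index (enumerates-left v e) (enumerates-right v e) rect =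
    map′ (Equivalence.from I⇔) (Equivalence.to I⇔) (_ ⊆? w)
    where I⇔ = Iᵀ⇔precedes {w = w} v refl refl f g rect

  precedes-lookup-trans : ∀ {w xs z} → Enumerates 1 n w →
    (∀ {x y} → Precedes xs x y → Precedes w x y) →
    ∀ f f′ → toℕ f ≤ toℕ f′ → Precedes w z (lookup xs f) → Precedes w z (lookup xs f′)
  precedes-lookup-trans e xs⇒w f f′ f≤f′ p with m≤n⇒m<n∨m≡n f≤f′
  ... | inj₁ f<f′ = precedes-trans (unique e) p (xs⇒w (precedes-lookup f f′ f<f′))
  ... | inj₂ eq with refl ← Fin.toℕ-injective eq = p

  lookup-precedes-trans : ∀ {w xs z} → Enumerates 1 n w →
    (∀ {x y} → Precedes xs x y → Precedes w x y) →
    ∀ f f′ → toℕ f ≤ toℕ f′ → Precedes w (lookup xs f′) z → Precedes w (lookup xs f) z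
  lookup-precedes-trans e xs⇒w f f′ f≤f′ p with m≤n⇒m<n∨m≡n f≤f′
  ... | inj₁ f<f′ = precedes-trans (unique e) (xs⇒w (precedes-lookup f f′ f<f′)) p
  ... | inj₂ eq with refl ← Fin.toℕ-injective eq = p

  -- Going down in R_k moves the left letter later in its subword and the right letter earlier in
  -- its own; both moves keep the right letter in front.
  Iᵀ-lower : ∀ {w x y} → Enumerates 1 n w → (n , σ) ⊢ x ≤ᴿ y → Iᵀ n σ w y → Iᵀ n σ w x
  Iᵀ-lower {w} e (k , x∈ , y∈ , x≤y) y∈I
    with a , b , v , rectx ← Rₖ⇒nodeAt x∈
    with recty ← Rₖ⇒rectangle v y∈
    with f , g , refl , refl ← rectangle-index (enumerates-left v e) (enumerates-right v e) rectx
       | f′ , g′ , refl , refl ← rectangle-index (enumerates-left v e) (enumerates-right v e) recty =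
    Equivalence.from (Iᵀ⇔precedes {w = w} v refl refl f g rectx)
      (precedes-lookup-trans e (valuesIn-precedes⁻ a k w) f′ f (+-cancelˡ-≤ a _ _ (proj₁ x≤y))
      (lookup-precedes-trans e (valuesIn-precedes⁻ (suc k) b w) g g′
        (+-cancelˡ-≤ (suc k) _ _ (proj₂ x≤y))
        (Equivalence.to (Iᵀ⇔precedes {w = w} v refl refl f′ g′ recty) y∈I)))

-- The map I

module _ {n : ℕ} {α : Composition n} {U T : Tree} {σ : List ℕ}
  (labels : HasLabelSet U (λ m → [1, n -1] m × ¬ J α m)) (U⊑T : U ⊑ T)
  (bst : BSTOf σ T) (ranged : 1 ≤ n → Ranged T 1 n) where

  P⇒1≤n : ∀ {x} → P n x → 1 ≤ n
  P⇒1≤n (1≤i , i<j , j≤n) = ≤-trans 1≤i (≤-trans (<⇒≤ i<j) j≤n)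

  J-below : ∀ {k a b m} → 1 ≤ n → NodeAt T 1 n k a b → J α k → a ≤ m → m < b → J α m
  -- A partial sum m would be a label of U in the subtree of k, although k itself is not a label of
  -- U.
  J-below {m = m} 1≤n v@(_ , _ , s) k∈J a≤m m<b = m∈ , λ ps →
    unlabelled-below U⊑T (ranged 1≤n) v (λ x → proj₂ (Equivalence.to (labels _) x) k∈J) a≤m m<b
      (Equivalence.from (labels m) (m∈ , λ (_ , ¬ps) → ¬ps ps))
    where
    m∈ : [1, n -1] m
    m∈ = let 1≤a , b≤n = subtree-bounds (ranged 1≤n) s in ≤-trans 1≤a a≤m , <-≤-trans m<b b≤n

  J? : ∀ m → Dec (J α m)
  J? m = ((1 ≤? m) ×-dec (m <? n)) ×-dec ¬? (Fin.any? λ k → m ≟ sum (take (suc (toℕ k)) (parts α)))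

  rectangle-Pα⇒∉J : ∀ {k a b x} → 1 ≤ n → NodeAt T 1 n k a b → InRectangle k a b x → Pα α x → ¬ J α k
  rectangle-Pα⇒∉J 1≤n v ((a≤i , _) , (_ , j≤b)) (_ , m , m∉J , i≤m , m<j) k∈J =
    m∉J (J-below 1≤n v k∈J (≤-trans a≤i i≤m) (<-≤-trans m<j j≤b))

  rectangle-∉J⇒Pα : ∀ {k a b x} → 1 ≤ n → NodeAt T 1 n k a b → InRectangle k a b x → ¬ J α k → Pα α x
  rectangle-∉J⇒Pα {k} 1≤n v rect@((_ , i≤k) , (k<j , _)) k∉J =
    rectangle⇒P bst (ranged 1≤n) v rect , k , k∉J , i≤k , k<j

  -- P_α is a union of whole rectangles, so testing the label of the splitting node replaces a
  -- search for the witness m.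
  Pα? : Decidable (Pα α)
  Pα? (i , j) with (1 ≤? i) ×-dec ((i <? j) ×-dec (j ≤? n))
  ... | no ij∉P = no (ij∉P ∘ proj₁)
  ... | yes ij∈P@(1≤i , i<j , j≤n)
    with k , a , b , v , rect ← splitting-node (ranged (P⇒1≤n ij∈P)) 1≤i i<j j≤n
    with J? k
  ...   | yes k∈J = no (λ ij∈Pα → rectangle-Pα⇒∉J (P⇒1≤n ij∈P) v rect ij∈Pα k∈J)
  ...   | no k∉J  = yes (rectangle-∉J⇒Pα (P⇒1≤n ij∈P) v rect k∉J)

  Pα⊆R : ∀ {x} → Pα α x → R α σ x
  Pα⊆R x∈Pα@((1≤i , i<j , j≤n) , _) =
    let p = ranged (P⇒1≤n (proj₁ x∈Pα))
        k , _ , _ , v , rect = splitting-node p 1≤i i<j j≤n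
    in (k , rectangle⇒Rₖ bst p v rect) , x∈Pα

  I-isLowerSet : ∀ u → IsLowerSetOfR α σ (I α σ u)
  I-isLowerSet u = record
    { decidable = I?
    ; subset    = λ (_ , x∈Pα) → Pα⊆R x∈Pα
    ; lower     = λ (_ , x∈Pα) (y∈I , _) x≤y →
        Iᵀ-lower bst (ranged (P⇒1≤n (proj₁ x∈Pα))) e x≤y y∈I , x∈Pα
    }
    where
    e = enumerates (standardization-isStandard α u)
    I? : Decidable (I α σ u)
    I? x with Pα? x
    ... | no x∉  = no (x∉ ∘ proj₂)
    ... | yes x∈ = map′ (_, x∈) proj₁ (Iᵀ-dec bst (ranged (P⇒1≤n (proj₁ x∈))) e (proj₁ x∈))

  -- Injectivity: recovering the word from I

  module _ (1≤n : 1 ≤ n) where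

    private
      p = ranged 1≤n

    -- I records a crossing pair only as "right letter before left letter", so one inclusion
    -- suffices for this order. The opposite order is handled in `subtree-precedes` by exchanging
    -- the two words and using totality.
    precedes-across : ∀ {k a b w w′} → NodeAt T 1 n k a b → ¬ J α k → Enumerates 1 n w →
      valuesIn a k w ≡ valuesIn a k w′ → valuesIn (suc k) b w ≡ valuesIn (suc k) b w′ →
      (∀ {x} → Pα α x → Iᵀ n σ w x → Iᵀ n σ w′ x) →
      ∀ {x y} → k < x → x ≤ b → a ≤ y → y ≤ k → Precedes w x y → Precedes w′ x y
    precedes-across {k} {a} {b} {w} {w′} v k∉J e eqL eqR I⊆I′ k<x x≤b a≤y y≤k pr
      with f , refl ← ∈⇒lookup (complete (enumerates-left bst p v e) a≤y y≤k)
      with g , refl ← ∈⇒lookup (complete (enumerates-right bst p v e) k<x x≤b) =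
      -- By `eqL` and `eqR`, the indices f and g name the same two values in `w′` as in `w`.
      Equivalence.to (Iᵀ⇔precedes bst p {w = w′} v (sym eqL) (sym eqR) f g rect)
        (I⊆I′ (rectangle-∉J⇒Pα 1≤n v rect k∉J)
          (Equivalence.from (Iᵀ⇔precedes bst p {w = w} v refl refl f g rect) pr))
      where
      rect : InRectangle k a b (a + toℕ f , suc k + toℕ g)
      rect = let a≤k , k<b = nodeAt-range p v in
        index-rectangle a≤k k<b (enumerates-left bst p v e) (enumerates-right bst p v e)
          (Fin.toℕ<n f) (Fin.toℕ<n g)

    subtree-∈ : ∀ {w t a b z} → IsStandard α w → Subtree t a b T 1 n → a ≤ z → z ≤ b → z ∈ w
    subtree-∈ st s a≤z z≤b =
      let 1≤a , b≤n = subtree-bounds p s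
      in complete (enumerates st) (≤-trans 1≤a a≤z) (≤-trans z≤b b≤n)

    module _ {w w′ : List ℕ} (st : IsStandard α w) (st′ : IsStandard α w′)
             (I⊆I′ : ∀ {x} → Pα α x → Iᵀ n σ w x → Iᵀ n σ w′ x)
             (I′⊆I : ∀ {x} → Pα α x → Iᵀ n σ w′ x → Iᵀ n σ w x) where

      -- Mutual with `subtree-valuesIn`: a crossing pair at a node can be transferred only after the
      -- subwords of both children are known to be equal.
      subtree-precedes : ∀ {t a b} → Subtree t a b T 1 n → ∀ {x y} → a ≤ x × x ≤ b → a ≤ y × y ≤ b →
                         Precedes w x y → Precedes w′ x y
      subtree-valuesIn : ∀ {t a b} → Subtree t a b T 1 n → valuesIn a b w ≡ valuesIn a b w′

      subtree-valuesIn {a = a} {b} s = enumerates-≡ ev (enumerates-valuesIn (enumerates st′) 1≤a b≤n)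
        (λ pr → valuesIn-precedes⁺ a b w′ (sound ev (precedes-∈ˡ pr)) (sound ev (precedes-∈ʳ pr))
          (subtree-precedes s (sound ev (precedes-∈ˡ pr)) (sound ev (precedes-∈ʳ pr))
            (valuesIn-precedes⁻ a b w pr)))
        where
        1≤a = proj₁ (subtree-bounds p s)
        b≤n = proj₂ (subtree-bounds p s)
        ev = enumerates-valuesIn (enumerates st) 1≤a b≤n

      subtree-precedes {leaf _} s (a≤x , x≤b) (a≤y , y≤b) pr with leaf ← subtree-ranged p s
        with refl ← ≤-antisym a≤x x≤b | refl ← ≤-antisym a≤y y≤b =
        contradiction pr (precedes-irrefl (unique (enumerates st)))
      subtree-precedes {node l k r} {a} {b} s {x} {y} (a≤x , x≤b) (a≤y , y≤b) pr with J? k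
      ... | yes k∈J = inJ (<-cmp x y)
        where
        ascend : ∀ {w x y} → IsStandard α w → a ≤ x → y ≤ b → x < y → Precedes w x y
        ascend st a≤x y≤b = precedes-chain (unique (enumerates st)) λ m x≤m m<y →
          ascending st (J-below 1≤n (_ , _ , s) k∈J (≤-trans a≤x x≤m) (<-≤-trans m<y y≤b))
        inJ : _ → Precedes w′ x y
        inJ (tri< x<y _ _)  = ascend st′ a≤x y≤b x<y
        inJ (tri≈ _ refl _) = contradiction pr (precedes-irrefl (unique (enumerates st)))
        inJ (tri> _ _ y<x)  =
          contradiction pr (precedes-asym (unique (enumerates st)) (ascend st a≤y x≤b y<x))
      ... | no k∉J with ≤-<-connex x k | ≤-<-connex y k
      ...   | inj₁ x≤k | inj₁ y≤k = subtree-precedes (subtree-left s) (a≤x , x≤k) (a≤y , y≤k) pr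
      ...   | inj₂ k<x | inj₂ k<y = subtree-precedes (subtree-right s) (k<x , x≤b) (k<y , y≤b) pr
      ...   | inj₂ k<x | inj₁ y≤k = precedes-across (_ , _ , s) k∉J (enumerates st)
        (subtree-valuesIn (subtree-left s)) (subtree-valuesIn (subtree-right s)) I⊆I′
        k<x x≤b a≤y y≤k pr
      ...   | inj₁ x≤k | inj₂ k<y
        with precedes-total (subtree-∈ st′ s a≤x x≤b) (subtree-∈ st′ s a≤y y≤b)
               (<⇒≢ (≤-<-trans x≤k k<y))
      ...     | inj₁ pr′ = pr′
      ...     | inj₂ pr′ = contradiction pr (precedes-asym (unique (enumerates st))
        (precedes-across (_ , _ , s) k∉J (enumerates st′) (sym (subtree-valuesIn (subtree-left s)))
          (sym (subtree-valuesIn (subtree-right s))) I′⊆I k<y y≤b a≤x x≤k pr′))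

  I-injective : ∀ {u v : Multiperm α} → I α σ u ≐ I α σ v → word u ≡ word v
  I-injective {u} {v} (u⊆v , v⊆u) = standardization-injective α {u} {v}
    (enumerates-≡ (enumerates su) (enumerates sv) λ pr →
      let x∈ = sound (enumerates su) (precedes-∈ˡ pr)
          y∈ = sound (enumerates su) (precedes-∈ʳ pr)
      in subtree-precedes (≤-trans (proj₁ x∈) (proj₂ x∈)) su sv
           (λ x∈ x∈I → proj₁ (u⊆v (x∈I , x∈))) (λ x∈ x∈I → proj₁ (v⊆u (x∈I , x∈))) here x∈ y∈ pr)
    where
    su = standardization-isStandard α u
    sv = standardization-isStandard α v

  -- Surjectivity: the word with a prescribed lower set

  module _ {L : Pred (ℕ × ℕ) 0ℓ} (isLower : IsLowerSetOfR α σ L) where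

    open IsLowerSet isLower

    L⊆Pα : ∀ {x} → L x → Pα α x
    L⊆Pα x∈L = proj₂ (subset x∈L)

    -- The inverse construction, from the leaves up. A leaf with empty label range at a contributes
    -- the single value a; at a node, 0-based positions p and q stand for the pair (a + p , k + 1 +
    -- q) of its rectangle.
    shuffle : Tree → ℕ → ℕ → List ℕ
    shuffle (leaf _)     a b = a ∷ []
    shuffle (node l k r) a b =
      merge (λ p q → decidable (a + p , suc k + q)) (shuffle l a k) (shuffle r (suc k) b)

    shuffle-enumerates : ∀ {t a b} → Ranged t a b → Enumerates a b (shuffle t a b)
    shuffle-enumerates leaf = record
      { unique   = [] ∷ []
      ; sound    = λ { (here refl) → ≤-refl , ≤-refl }
      ; complete = λ a≤x x≤a → here (≤-antisym x≤a a≤x)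
      }
    shuffle-enumerates (node p q) =
      enumerates-merge _ (ranged-≤ p) (ranged-≤ q) (shuffle-enumerates p) (shuffle-enumerates q)

    -- Merging higher up never reorders the letters of a subtree, and the letters it inserts are
    -- outside [a , b]. So the subwords that `Iᵀ` reads at a node are those that were shuffled
    -- there.
    shuffle-valuesIn : ∀ {t a b T A B} → Ranged T A B → Subtree t a b T A B →
                       valuesIn a b (shuffle T A B) ≡ shuffle t a b
    shuffle-valuesIn p here = filter-all _ (All.tabulate (sound (shuffle-enumerates p)))
    shuffle-valuesIn {T = node l k r} {A} {B} (node p q) (left s) =
      trans (filter-mergeˡ _ _ (shuffle l A k) (shuffle r (suc k) B) (All.tabulate λ y∈ (_ , y≤b) →
              <⇒≱ (proj₁ (sound (shuffle-enumerates q) y∈)) (≤-trans y≤b (proj₂ (subtree-bounds p s)))))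
            (shuffle-valuesIn p s)
    shuffle-valuesIn {T = node l k r} {A} {B} (node p q) (right s) =
      trans (filter-mergeʳ _ _ (shuffle l A k) (shuffle r (suc k) B) (All.tabulate λ x∈ (a≤x , _) →
              <⇒≱ (≤-trans (proj₁ (subtree-bounds q s)) a≤x) (proj₂ (sound (shuffle-enumerates p) x∈))))
            (shuffle-valuesIn q s)

    module _ (1≤n : 1 ≤ n) where

      private
        p = ranged 1≤n
        ω = shuffle T 1 n

        ω-enumerates : Enumerates 1 n ω
        ω-enumerates = shuffle-enumerates p

      module _ {l r k a b} (s : Subtree (node l k r) a b T 1 n) where

        private
          ν : NodeAt T 1 n k a b
          ν = _ , _ , s

          left-enumerates : Enumerates a k (shuffle l a k)
          left-enumerates = shuffle-enumerates (subtree-ranged p (subtree-left s))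

          right-enumerates : Enumerates (suc k) b (shuffle r (suc k) b)
          right-enumerates = shuffle-enumerates (subtree-ranged p (subtree-right s))

          rect : ∀ {c d} → c < length (shuffle l a k) → d < length (shuffle r (suc k) b) →
                 InRectangle k a b (a + c , suc k + d)
          rect = let a≤k , k<b = nodeAt-range p ν
                 in index-rectangle a≤k k<b left-enumerates right-enumerates

          lowerOn : LowerOn (length (shuffle l a k)) (length (shuffle r (suc k) b))
                            (λ c d → L (a + c , suc k + d))
          lowerOn c≤c′ c′< d′≤d d< x∈L = lower
            ((k , x′∈) , rectangle-∉J⇒Pα 1≤n ν (rect c′< (≤-<-trans d′≤d d<)) k∉J) x∈L
            (k , x′∈ , rectangle⇒Rₖ bst p ν (rect (≤-<-trans c≤c′ c′<) d<) ,
                 +-monoʳ-≤ a c≤c′ , +-monoʳ-≤ (suc k) d′≤d)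
            where
            x′∈ = rectangle⇒Rₖ bst p ν (rect c′< (≤-<-trans d′≤d d<))
            -- The larger pair lies in L and so in P_α, which keeps k out of J; hence the smaller
            -- pair is in P_α too, as `lower` requires.
            k∉J = rectangle-Pα⇒∉J 1≤n ν (rect (≤-<-trans c≤c′ c′<) d<) (L⊆Pα x∈L)

          merge⇒ω : ∀ {x y} → Precedes (shuffle (node l k r) a b) x y → Precedes ω x y
          merge⇒ω {x} {y} pr = valuesIn-precedes⁻ a b ω
            (subst (λ w → Precedes w x y) (sym (shuffle-valuesIn p s)) pr)

        shuffle-precedes-no : ∀ f g → ¬ L (a + toℕ f , suc k + toℕ g) →
          Precedes ω (lookup (shuffle l a k) f) (lookup (shuffle r (suc k) b) g)
        shuffle-precedes-no f g x∉L = merge⇒ω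
          (merge-precedes-no _ (shuffle l a k) (shuffle r (suc k) b) lowerOn f g x∉L)

        shuffle-Iᵀ⇔L : ∀ {x} → InRectangle k a b x → Iᵀ n σ ω x ⇔ L x
        shuffle-Iᵀ⇔L rectx
          with f , g , refl , refl ← rectangle-index left-enumerates right-enumerates rectx =
          mk⇔ to from
          where
          I⇔ = Iᵀ⇔precedes bst p {w = ω} ν (shuffle-valuesIn p (subtree-left s))
                 (shuffle-valuesIn p (subtree-right s)) f g rectx
          from : L (a + toℕ f , suc k + toℕ g) → Iᵀ n σ ω (a + toℕ f , suc k + toℕ g)
          from x∈L = Equivalence.from I⇔ (merge⇒ω
            (merge-precedes-yes _ (shuffle l a k) (shuffle r (suc k) b) lowerOn f g x∈L))
          to : Iᵀ n σ ω (a + toℕ f , suc k + toℕ g) → L (a + toℕ f , suc k + toℕ g)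
          to x∈I with decidable (a + toℕ f , suc k + toℕ g)
          ... | yes x∈L = x∈L
          ... | no x∉L  = contradiction (shuffle-precedes-no f g x∉L)
            (precedes-asym (unique ω-enumerates) (Equivalence.to I⇔ x∈I))

        -- For k in J the rectangle misses L, so every letter of the left word precedes every letter
        -- of the right word; k and k + 1 are one such pair.
        shuffle-ascending : J α k → Precedes ω k (suc k)
        shuffle-ascending k∈J =
          let a≤k , k<b = nodeAt-range p ν
              f , f≡k   = ∈⇒lookup (complete left-enumerates a≤k ≤-refl)
              g , g≡1+k = ∈⇒lookup (complete right-enumerates ≤-refl k<b)
          in subst₂ (Precedes ω) f≡k g≡1+k (shuffle-precedes-no f g λ x∈L →
               rectangle-Pα⇒∉J 1≤n ν (rect (Fin.toℕ<n f) (Fin.toℕ<n g)) (L⊆Pα x∈L) k∈J)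

      shuffle-isStandard : IsStandard α ω
      shuffle-isStandard = record
        { enumerates = ω-enumerates
        ; ascending  = asc
        }
        where
        asc : ∀ {m} → J α m → Precedes ω m (suc m)
        asc m∈J@((1≤m , m<n) , _)
          -- The node separating m from m + 1 can only be m itself.
          with k , a , b , (_ , _ , s) , ((_ , m≤k) , (k<1+m , _)) ← splitting-node p 1≤m ≤-refl m<n
          with refl ← ≤-antisym m≤k (s≤s⁻¹ k<1+m) = shuffle-ascending s m∈J

      shuffle-I⇔L : ∀ {x} → Pα α x → Iᵀ n σ ω x ⇔ L x
      shuffle-I⇔L ((1≤i , i<j , j≤n) , _) =
        let k , a , b , (_ , _ , s) , rect = splitting-node p 1≤i i<j j≤n in shuffle-Iᵀ⇔L s rect

    isStandard-with-I : Σ[ w ∈ List ℕ ] IsStandard α w × (∀ {x} → Pα α x → Iᵀ n σ w x ⇔ L x)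
    isStandard-with-I with 1 ≤? n
    ... | yes 1≤n = shuffle T 1 n , shuffle-isStandard 1≤n , shuffle-I⇔L 1≤n
    -- `shuffle` never returns the empty word, so the word for n = 0 is supplied by hand.
    ... | no 1≰n  = [] , empty , λ x∈ → contradiction (P⇒1≤n (proj₁ x∈)) 1≰n
      where
      empty : IsStandard α []
      empty = record
        { enumerates = record
          { unique   = []
          ; sound    = λ ()
          ; complete = λ 1≤x x≤n → contradiction (≤-trans 1≤x x≤n) 1≰n
          }
        ; ascending = λ ((1≤m , m<n) , _) → contradiction (≤-trans 1≤m (<⇒≤ m<n)) 1≰n
        }

    -- Surjectivity between setoids asks for the image of every z equal to u, and `_≈_` compares
    -- only the words; hence the quantification over z.
    I-surjective : Σ[ u ∈ Multiperm α ] (∀ {z : Multiperm α} → word z ≡ word u → I α σ z ≐ L)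
    I-surjective
      with w , st , I⇔L ← isStandard-with-I
      with u , refl ← standardization-surjective α st = u , λ {z} z≈u →
        (λ (x∈I , x∈) → Equivalence.to (I⇔L x∈)
           (subst (λ w → Iᵀ n σ w _) (standardization-cong α {z} {u} z≈u) x∈I)) ,
        (λ x∈L → subst (λ w → Iᵀ n σ w _) (sym (standardization-cong α {z} {u} z≈u))
           (Equivalence.from (I⇔L (L⊆Pα x∈L)) x∈L) , L⊆Pα x∈L)

-- The lattice of lower sets

module _ {S : Pred (ℕ × ℕ) 0ℓ} {_≤_ : Rel (ℕ × ℕ) 0ℓ} {L M : Pred (ℕ × ℕ) 0ℓ}
  (isL : IsLowerSet S _≤_ L) (isM : IsLowerSet S _≤_ M) where

  private
    module L = IsLowerSet isL
    module M = IsLowerSet isM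

  ∪-isLowerSet : IsLowerSet S _≤_ (L ∪ M)
  ∪-isLowerSet = record
    { decidable = λ x → L.decidable x ⊎-dec M.decidable x
    ; subset    = [ L.subset , M.subset ]′
    ; lower     = λ x∈S y∈ x≤y → Sum.map (λ y∈L → L.lower x∈S y∈L x≤y)
                                           (λ y∈M → M.lower x∈S y∈M x≤y) y∈
    }

  ∩-isLowerSet : IsLowerSet S _≤_ (L ∩ M)
  ∩-isLowerSet = record
    { decidable = λ x → L.decidable x ×-dec M.decidable x
    ; subset    = L.subset ∘ proj₁
    ; lower     = λ x∈S (y∈L , y∈M) x≤y → L.lower x∈S y∈L x≤y , M.lower x∈S y∈M x≤y
    }

module _ {n : ℕ} (α : Composition n) (σ : List ℕ) (lower : ∀ u → IsLowerSetOfR α σ (I α σ u))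
  (bijective : Bijective _≈_ (_≐ᴸ_ α σ) (λ u → I α σ u , lower u)) where

  private
    injective : ∀ {u v} → I α σ u ≐ I α σ v → u ≈ v
    injective {u} {v} = proj₁ bijective {u} {v}

    preimage : LowerSets α σ → Multiperm α
    preimage L = proj₁ (proj₂ bijective L)

    I-preimage : ∀ L → I α σ (preimage L) ≐ proj₁ L
    I-preimage L = proj₂ (proj₂ bijective L) {preimage L} refl

    join meet : Multiperm α → Multiperm α → LowerSets α σ
    join u v = I α σ u ∪ I α σ v , ∪-isLowerSet (lower u) (lower v)
    meet u v = I α σ u ∩ I α σ v , ∩-isLowerSet (lower u) (lower v)

  -- The order is defined through I, so it suffices that unions and intersections of images have
  -- preimages; every law is then checked on sets and brought back by injectivity.
  ≤ᵁ-isDistributiveLattice :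
    IsDistributiveLattice _≈_ (_≤ᵁ_ α σ) (λ u v → preimage (join u v)) (λ u v → preimage (meet u v))
  ≤ᵁ-isDistributiveLattice = record
    { isLattice = record
      { isPartialOrder = record
        { isPreorder = record
          { isEquivalence = record { refl = refl ; sym = sym ; trans = trans }
          ; reflexive     = λ {u} {v} u≈v → proj₁ (I-cong {u} {v} u≈v)
          ; trans         = λ u≤v v≤w → v≤w ∘ u≤v
          }
        ; antisym = λ {u} {v} u≤v v≤u → injective {u} {v} (u≤v , v≤u)
        }
      ; supremum = λ u v → let to , from = I-preimage (join u v) in
          from ∘ inj₁ , from ∘ inj₂ , λ w u≤w v≤w → [ u≤w , v≤w ]′ ∘ to
      ; infimum  = λ u v → let to , from = I-preimage (meet u v) in
          proj₁ ∘ to , proj₂ ∘ to , λ w w≤u w≤v x∈ → from (w≤u x∈ , w≤v x∈)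
      }
    ; ∧-distribˡ-∨ = distrib
    }
    where
    I-cong : ∀ {u v : Multiperm α} → u ≈ v → I α σ u ≐ I α σ v
    I-cong {u} {v} u≈v =
      subst (λ w → (Iᵀ n σ (standardization u) ∩ Pα α) ≐ (Iᵀ n σ w ∩ Pα α))
        (standardization-cong α {u} {v} u≈v) (id , id)
    distrib : ∀ u v w → preimage (meet u (preimage (join v w))) ≈
                        preimage (join (preimage (meet u v)) (preimage (meet u w)))
    distrib u v w = injective {preimage u∧[v∨w]} {preimage [u∧v]∨[u∧w]}
      ( (λ x∈ → let x∈u , x∈v∨w = proj₁ (I-preimage u∧[v∨w]) x∈ in
           proj₂ (I-preimage [u∧v]∨[u∧w])
             (Sum.map (λ x∈v → proj₂ (I-preimage (meet u v)) (x∈u , x∈v))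
                      (λ x∈w → proj₂ (I-preimage (meet u w)) (x∈u , x∈w))
                      (proj₁ (I-preimage (join v w)) x∈v∨w)))
      , (λ x∈ → proj₂ (I-preimage u∧[v∨w])
           ([ (λ x∈u∧v → let x∈u , x∈v = proj₁ (I-preimage (meet u v)) x∈u∧v in
                x∈u , proj₂ (I-preimage (join v w)) (inj₁ x∈v))
            , (λ x∈u∧w → let x∈u , x∈w = proj₁ (I-preimage (meet u w)) x∈u∧w in
                x∈u , proj₂ (I-preimage (join v w)) (inj₂ x∈w))
            ]′ (proj₁ (I-preimage [u∧v]∨[u∧w]) x∈))) )
      where
      u∧[v∨w]     = meet u (preimage (join v w))
      [u∧v]∨[u∧w] = join (preimage (meet u v)) (preimage (meet u w))

theorem6p1 : ∀ {n : ℕ} (α : Composition n)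
    (U : Tree) → IsBST U → HasLabelSet U (λ m → [1, n -1] m × ¬ J α m) →
    (T : Tree) → IsCompletion n U T →
    (σ : List ℕ) → IsPermutation (n ∸ 1) σ → BSTOf σ T →
    (Σ[ lower ∈ (∀ u → IsLowerSetOfR α σ (I α σ u)) ]
    Bijective _≈_ (_≐ᴸ_ α σ) (λ u → I α σ u , lower u))
    × (∃₂ λ _∨_ _∧_ → IsDistributiveLattice _≈_ (_≤ᵁ_ α σ) _∨_ _∧_)
theorem6p1 {n} α U _ labels T completion σ _ bst =
  (lower , bijective) , _ , _ , ≤ᵁ-isDistributiveLattice α σ lower bijective
  where
  open IsCompletion completion
  ranged : 1 ≤ n → Ranged T 1 n
  ranged 1≤n = isBST⇒ranged isBST 1≤n labelSet
  lower : ∀ u → IsLowerSetOfR α σ (I α σ u)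
  lower = I-isLowerSet labels extends bst ranged
  bijective : Bijective _≈_ (_≐ᴸ_ α σ) (λ u → I α σ u , lower u)
  bijective = (λ {u} {v} → I-injective labels extends bst ranged {u} {v}) ,
              λ (_ , isL) → I-surjective labels extends bst ranged isL
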